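{- Every subcubic planar graph with girth at least $16$ has a $(1,2^4)$-packing edge-coloring.
   Context: Graphs are finite and simple. A graph is subcubic if its maximum degree is at most $3$. The girth of a graph is the length of a shortest cycle, with the girth of a forest taken to be infinite. For distinct edges $e,f$ of $G$, the distance between $e$ and $f$ is the distance between the corresponding vertices of the line graph $L(G)$ (so edges sharing an endpoint are at distance $1$). A $(1^j,2^k)$-packing edge-coloring of $G$ is a partition of $E(G)$ into $j+k$ classes (possibly empty) such that in each of the first $j$ classes any two distinct edges are at distance at least $2$ (the class is a matching), and in each of the remaining $k$ classes any two distinct edges are at distance at least $3$ (the class is an induced matching). Thus a $(1,2^4)$-packing edge-coloring is a partition of $E(G)$ into one matching and four induced matchings. -}

module Defs where

open import Data.Bool using (Bool; true; false; T)
open import Data.Fin using (Fin; zero; suc; fromℕ; inject₁)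
  renaming (_<_ to _<ᶠ_)
open import Data.Fin.Subset using (Subset; ∣_∣)
open import Data.Nat using (ℕ; zero; suc; _+_; _*_; _≤_)
open import Level using (0ℓ)
open import Data.Product using (∃; _×_)
open import Data.Sum using (_⊎_; inj₁; inj₂)
open import Data.Vec using (tabulate)
open import Function.Base using (_∘_)
open import Function.Bundles using (_⇔_; _↔_; Inverse)
open import Function.Definitions using (Injective; Surjective)
open import Relation.Binary.Construct.Closure.ReflexiveTransitive
  using (Star; fold)
open import Relation.Binary.Core using (Rel)
open import Relation.Binary.PropositionalEquality
  using (_≡_; _≢_; subst)

record Graph (n : ℕ) : Set where
  field
    adj        : Fin n → Fin n → Bool
    adj-sym    : ∀ u v → adj u v ≡ adj v u
    adj-irrefl : ∀ v → adj v v ≡ false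

  Adj : Rel (Fin n) 0ℓ
  Adj u v = T (adj u v)

  neighbours : Fin n → Subset n
  neighbours v = tabulate (adj v)

  degree : Fin n → ℕ
  degree v = ∣ neighbours v ∣

open Graph public

Subcubic : ∀ {n} → Graph n → Set
Subcubic G = ∀ v → degree G v ≤ 3

-- The vertices  vertex 0, …, vertex m  are distinct and cyclically adjacent;
-- the length of the cycle is  suc m.
record Cycle {n} (G : Graph n) (m : ℕ) : Set where
  field
    3≤length  : 3 ≤ suc m
    vertex    : Fin (suc m) → Fin n
    injective : Injective _≡_ _≡_ vertex
    step      : ∀ (i : Fin m) → Adj G (vertex (inject₁ i)) (vertex (suc i))
    close     : Adj G (vertex (fromℕ m)) (vertex zero)

-- Vacuously true for forests, whose girth is infinite.
GirthAtLeast : ∀ {n} → ℕ → Graph n → Set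
GirthAtLeast g G = ∀ {m} → Cycle G m → g ≤ suc m

-- An edge is an unordered pair, stored with its smaller endpoint first.
record Edge {n} (G : Graph n) : Set where
  constructor edge
  field
    lo hi    : Fin n
    lo<hi    : lo <ᶠ hi
    adjacent : Adj G lo hi

_isEndOf_ : ∀ {n} {G : Graph n} → Fin n → Edge G → Set
w isEndOf e = w ≡ Edge.lo e ⊎ w ≡ Edge.hi e

LineAdj : ∀ {n} (G : Graph n) → Rel (Edge G) 0ℓ
LineAdj G e f = e ≢ f × ∃ λ w → w isEndOf e × w isEndOf f

Walk : {A : Set} → Rel A 0ℓ → Rel A 0ℓ
Walk = Star

walkLength : {A : Set} {R : Rel A 0ℓ} {x y : A} → Walk R x y → ℕ
walkLength = fold (λ _ _ → ℕ) (λ _ ℓ → suc ℓ) 0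

-- Distance is the least length of a walk, and infinite if there is none.
DistAtLeast : {A : Set} → Rel A 0ℓ → ℕ → Rel A 0ℓ
DistAtLeast R d x y = (w : Walk R x y) → d ≤ walkLength w

EdgeDistAtLeast : ∀ {n} (G : Graph n) → ℕ → Rel (Edge G) 0ℓ
EdgeDistAtLeast G = DistAtLeast (LineAdj G)

-- (1^j , 2^k)-packing edge-coloring: the classes are the fibres of  colour.
record PackingEdgeColoring {n} (j k : ℕ) (G : Graph n) : Set where
  field
    colour   : Edge G → Fin j ⊎ Fin k
    matching : ∀ (i : Fin j) {e f} → colour e ≡ inj₁ i → colour f ≡ inj₁ i →
               e ≢ f → EdgeDistAtLeast G 2 e f
    induced  : ∀ (i : Fin k) {e f} → colour e ≡ inj₂ i → colour f ≡ inj₂ i →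
               e ≢ f → EdgeDistAtLeast G 3 e f

-- Planarity.  An embedding of a graph in an oriented closed surface is encoded
-- as a combinatorial map: a rotation system on the darts (oriented edges) that
-- cyclically orders the darts leaving each vertex.

record Dart {n} (G : Graph n) : Set where
  constructor dart
  field
    src tgt  : Fin n
    adjacent : Adj G src tgt

open Dart public using (src; tgt)

rev : ∀ {n} {G : Graph n} → Dart G → Dart G
rev {G = G} (dart u v p) = dart v u (subst T (adj-sym G u v) p)

-- For a permutation of a finite set, forward reachability is the orbit relation.
SameOrbit : {A : Set} → (A → A) → Rel A 0ℓ
SameOrbit f = Star (λ x y → f x ≡ y)

-- R  is an equivalence relation with exactly  k  classes.
record Classes {A : Set} (R : Rel A 0ℓ) (k : ℕ) : Set where
  field
    class      : A → Fin k
    surjective : Surjective _≡_ _≡_ class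
    fibres     : ∀ x y → class x ≡ class y ⇔ R x y

record RotationSystem {n} (G : Graph n) : Set where
  field
    rotation : Dart G ↔ Dart G

  next : Dart G → Dart G
  next = Inverse.to rotation

  field
    vertexOrbits : ∀ d d′ → src d ≡ src d′ ⇔ SameOrbit next d d′

  -- Traverse a dart, then leave its target along the next dart of the
  -- rotation; the orbits are the facial walks.
  face : Dart G → Dart G
  face = next ∘ rev

-- A rotation system of genus zero, i.e. an embedding of each connected
-- component in a sphere.  Everything is counted on darts, so isolated vertices
-- are ignored (they do not affect planarity), and faces are counted separately
-- for each component.  Summing  V − E + F = 2 − 2·genus  over the components
-- and using  genus ≥ 0, the equation  euler  says that every genus is zero.
record Planar {n} (G : Graph n) : Set where
  field
    rotationSystem : RotationSystem G

  open RotationSystem rotationSystem public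

  field
    #V #E #F #C : ℕ
    vertices   : Classes (SameOrbit next) #V
    edges      : Classes (SameOrbit (rev {G = G})) #E
    faces      : Classes (SameOrbit face) #F
    components : Classes {A = Dart G} (λ d d′ → Walk (Adj G) (src d) (src d′)) #C
    euler      : #V + #F ≡ #E + 2 * #C

{-# OPTIONS --safe #-}
module Submission where

-- Label every vertex by a two-element subset of {1,2,3,4} so that neighbours
-- have different labels, give an edge colour 0 if its two labels are
-- complementary and their common element otherwise, and require the edges at
-- each vertex to have different colours.  If two edges of colour c ≠ 0 were
-- joined by a third edge, both labels of that edge would contain c, so it
-- would have colour c as well; hence such a labelling is a packing colouring.
--
-- Labellings are found by induction over induced subgraphs X.  A vertex of
-- degree at most 1 in X is easily put back.  Otherwise Euler's formula for X
-- yields a region of X whose boundary contains a cycle with at most 5 vertices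
-- of degree 3.  Its length is at least 16 > 3 · 5, so by the cycle lemma one
-- can start on it with a thread of three vertices of degree 2 and continue
-- with blocks of one vertex of degree 3 and two of degree 2, until either
-- another vertex of degree 2 follows or the cycle closes.  Delete these
-- vertices, label the rest, and put the blocks back from the far end, keeping
-- three options for the last edge so that the thread, inserted last, does not
-- meet its only obstruction: both its end edges having colour 0 and the same
-- label outside.
--
-- Euler's formula passes from G to X by joining the faces of G across deleted
-- edges: the joining edges form a forest in the dual, hence removing them does
-- not disconnect G, which bounds their number.

open import Defs
open import Data.Nat using (ℕ)

open import Data.Bool using (Bool; true; false; T; if_then_else_; _∧_; _∨_; _xor_; not)
open import Data.Bool.Properties using (T?; T-irrelevant)
open import Data.Empty using (⊥; ⊥-elim)
open import Data.Fin using (Fin; zero; suc; _≟_; toℕ; fromℕ; fromℕ<; inject₁; opposite; _↑ˡ_; _↑ʳ_; splitAt)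
  renaming (_<_ to _<ᶠ_)
open import Data.Fin.Induction using (<-wellFounded)
open import Data.Fin.Patterns using (0F; 1F; 2F; 3F; 4F; 5F)
open import Data.Fin.Permutation using (permutation)
open import Data.Fin.Properties
  using (any?; injective⇒≤; join-splitAt; splitAt-↑ˡ; splitAt-↑ʳ; suc-injective;
         toℕ-fromℕ; toℕ-fromℕ<; toℕ-injective; toℕ-inject₁; toℕ<n; toℕ≤pred[n])
  renaming (<-cmp to <ᶠ-cmp)
open import Data.Fin.Subset using (∣_∣)
open import Data.Nat using (zero; suc; pred; _+_; _*_; _∸_; _/_; _%_; _≤_; _<_; z≤n; s≤s; _≤?_; _≡ᵇ_)
  renaming (_≟_ to _≟ⁿ_)
open import Data.Nat.DivMod using (m%n<n; m<n⇒m%n≡m; [m+kn]%n≡m%n; [m+n]%n≡m%n; n%n≡0; m≡m%n+[m/n]*n)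
open import Data.Nat.Properties hiding (_≟_; suc-injective)
open import Algebra.Properties.CommutativeMonoid.Sum +-0-commutativeMonoid
  using (sum; sum-cong-≗; ∑-distrib-+; ∑-comm; sum-permute)
open import Data.Nat.Solver using (module +-*-Solver)
open import Data.Product using (∃; ∃₂; _×_; _,_; proj₁; proj₂)
open import Data.Sum using (_⊎_; inj₁; inj₂; [_,_]′; map)
open import Data.Unit using (tt)
open import Data.Vec using (tabulate)
open import Function.Base using (_∘_; id)
open import Function.Bundles using (Inverse; Equivalence)
open import Induction.WellFounded using (Acc; acc)
open import Relation.Binary.Construct.Closure.ReflexiveTransitive using (ε; _◅_)
open import Relation.Binary.Definitions using (Tri; tri<; tri≈; tri>)
open import Relation.Binary.PropositionalEquality hiding ([_])
open import Relation.Nullary using (Dec; does; ¬_; yes; no)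
open import Relation.Nullary.Decidable using (_×-dec_; ¬?; dec-true; dec-false)

-- Labels, slots and colours

-- The bound 5 comes from counting corners of regions at the vertices of degree 3 in `X`; each such
-- vertex has at most three. If every region with a boundary had at least 6 of these corners, there
-- would be at most half as many such regions as vertices of degree 3, whereas Euler's formula with
-- minimum degree 2 forces more than half as many. Girth 16 enters twice. Besides 16 > 3 · 5, it
-- excludes a chord spanning at most 14 steps of the cycle, so the third neighbour of a vertex of
-- degree 3 in the chain is never a vertex whose label depends on the option chosen at the far end.
-- A single state carried back through the blocks could end in the obstruction of the thread. Hence
-- a family of three states, `member P Q`, is carried along, and its shape reproduces itself across
-- a block whatever the state of the third neighbour. These local facts concern six labels and three
-- slots only and hold by evaluation.

∧-elim : ∀ a {b} → T (a ∧ b) → T a × T b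
∧-elim true t = tt , t

∨-elim : ∀ a {b} → T (a ∨ b) → T a ⊎ T b
∨-elim true  t = inj₁ tt
∨-elim false t = inj₂ t

opaque
  -- Exhaustive search in Boolean form. Each local fact about labels and slots below is a finite
  -- statement of this kind, so its proof is the evaluation to `true`.
  every some : ∀ {n} → (Fin n → Bool) → Bool
  every {zero}  p = true
  every {suc n} p = p zero ∧ every (p ∘ suc)
  some {zero}  p = false
  some {suc n} p = p zero ∨ some (p ∘ suc)

  every-sound : ∀ {n} (p : Fin n → Bool) → T (every p) → ∀ i → T (p i)
  every-sound p t zero    = proj₁ (∧-elim (p zero) t)
  every-sound p t (suc i) = every-sound (p ∘ suc) (proj₂ (∧-elim (p zero) t)) i

  some-sound : ∀ {n} (p : Fin n → Bool) → T (some p) → ∃ λ i → T (p i)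
  some-sound {suc n} p t with ∨-elim (p zero) t
  ... | inj₁ h = zero , h
  ... | inj₂ h with some-sound (p ∘ suc) h
  ...   | i , h′ = suc i , h′

every₂-sound : ∀ {k l} (p : Fin k → Fin l → Bool) →
  T (every λ i → every (p i)) → ∀ i j → T (p i j)
every₂-sound p t i = every-sound (p i) (every-sound (λ i → every (p i)) t i)

every₄-sound : ∀ {k l m n} (p : Fin k → Fin l → Fin m → Fin n → Bool) →
  T (every λ i → every λ j → every λ k → every (p i j k)) → ∀ i j k l → T (p i j k l)
every₄-sound p t i j =
  every₂-sound (p i j) (every₂-sound (λ i j → every λ k → every (p i j k)) t i j)

infixr 4 _⇒ᵇ_

opaque
  some₂-sound : ∀ {k l} (p : Fin k → Fin l → Bool) →
    T (some λ i → some (p i)) → ∃₂ λ i j → T (p i j)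
  some₂-sound p t with some-sound (λ i → some (p i)) t
  ... | i , h with some-sound (p i) h
  ...   | j , h′ = i , j , h′

_⇒ᵇ_ : Bool → Bool → Bool
a ⇒ᵇ b = not a ∨ b

⇒ᵇ-elim : ∀ a {b} → T (a ⇒ᵇ b) → T a → T b
⇒ᵇ-elim true h _ = h

infix 8 _==_

opaque
  _==_ : ∀ {n} → Fin n → Fin n → Bool
  i == j = does (i ≟ j)

  ==-sound : ∀ {n} {i j : Fin n} → T (i == j) → i ≡ j
  ==-sound {i = i} {j} t with i ≟ j
  ... | yes p = p

  ==-refl : ∀ {n} (i : Fin n) → T (i == i)
  ==-refl i with i ≟ i
  ... | yes _ = tt
  ... | no ¬p = ¬p refl

  /=-sound : ∀ {n} {i j : Fin n} → T (not (i == j)) → i ≢ j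
  /=-sound {i = i} {j} t with i ≟ j
  ... | no ¬p = ¬p

  /=-complete : ∀ {n} {i j : Fin n} → i ≢ j → T (not (i == j))
  /=-complete {i = i} {j} ¬p with i ≟ j
  ... | yes p = ¬p p
  ... | no _  = tt

Label Slot Colour State : Set
Label  = Fin 6
Slot   = Fin 3
Colour = Fin 5
State  = Label × Slot

-- Label  P  stands for the  P-th two-element set of the colours 1, …, 4 in
-- lexicographic order, so that complementary sets have opposite labels.
-- Slot 0 of a label carries colour 0, slots 1 and 2 carry its two elements.
colourOf : State → Colour
colourOf (_  , 0F) = 0F
colourOf (0F , 1F) = 1F
colourOf (0F , 2F) = 2F
colourOf (1F , 1F) = 1F
colourOf (1F , 2F) = 3F
colourOf (2F , 1F) = 1F
colourOf (2F , 2F) = 4F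
colourOf (3F , 1F) = 2F
colourOf (3F , 2F) = 3F
colourOf (4F , 1F) = 2F
colourOf (4F , 2F) = 4F
colourOf (5F , 1F) = 3F
colourOf (5F , 2F) = 4F

opaque
  unfolding _==_

  -- Compatibility of the two darts of one edge. For positive slots, `P` and `Q` being different
  -- makes the shared colour their only common element, so the two labels determine the colour of
  -- the edge.
  fits : State → State → Bool
  fits (P , 0F) (Q , 0F) = Q == opposite P
  fits (P , 0F) (Q , suc _) = false
  fits (P , suc _) (Q , 0F) = false
  fits s@(P , suc _) t@(Q , suc _) = colourOf s == colourOf t ∧ not (P == Q)

Fits : State → State → Set
Fits s t = T (fits s t)

third : Slot → Slot → Slot
third 0F 1F = 2F
third 1F 0F = 2F
third 0F 2F = 1F
third 2F 0F = 1F
third 1F 2F = 0F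
third 2F 1F = 0F
third a  _  = a

contains : Label → Colour → Bool
contains P x = some λ i → colourOf (P , suc i) == x

meets : Label → Label → Bool
meets P Q = not (P == Q) ∧ not (Q == opposite P)

-- Two intersecting labels  P, Q  index the states  (P,0), (Q,0), (P,x)  where
-- x ∉ Q;  otherwise the pair indexes  (P,1), (P,2).
opaque
  member : Label → Label → Fin 3 → State
  member P Q i = if meets P Q then crossing i else flat i
    where
    crossing flat : Fin 3 → State
    crossing 0F = P , 0F
    crossing 1F = Q , 0F
    crossing 2F = P , (if contains Q (colourOf (P , 1F)) then 2F else 1F)
    flat 0F = P , 1F
    flat _  = P , 2F

-- A dart in state  s  enters a vertex with two neighbours; the other dart
-- leaves it in state  t.
record Step (s t : State) : Set where
  constructor through
  field
    in-slot : Slot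
    distinct : in-slot ≢ proj₂ t
    fit : Fits s (proj₁ t , in-slot)

someStep : State → (State → Bool) → Bool
someStep s k = some λ Q → some λ a → fits s (Q , a) ∧ some λ b → not (a == b) ∧ k (Q , b)

opaque
  someStep-sound : ∀ s (k : State → Bool) → T (someStep s k) → ∃ λ t → Step s t × T (k t)
  someStep-sound s k h with some₂-sound (λ Q a → fits s (Q , a) ∧ some λ b → not (a == b) ∧ k (Q , b)) h
  ... | Q , a , h₂ with ∧-elim (fits s (Q , a)) h₂
  ... | f , h₃ with some-sound (λ b → not (a == b) ∧ k (Q , b)) h₃
  ... | b , h₄ with ∧-elim (not (a == b)) h₄
  ... | d , h₅ = (Q , b) , through a (/=-sound d) f , h₅

-- Closed form of: two vertices of degree 2 fit between darts in states  s, t.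
opaque
  linked : State → State → Bool
  linked (P , 0F) (Q , 0F) = meets P Q
  linked (P , 0F) t@(_ , suc _) = contains P (colourOf t)
  linked s@(_ , suc _) (Q , 0F) = contains Q (colourOf s)
  linked s@(_ , suc _) t@(_ , suc _) = not (colourOf s == colourOf t)

someStep₂ : State → State → Bool
someStep₂ s t = someStep s λ s₁ → someStep s₁ λ s₂ → fits s₂ t

linked-check : Label → Slot → Label → Slot → Bool
linked-check P a Q b = linked (P , a) (Q , b) ⇒ᵇ someStep₂ (P , a) (Q , b)

opaque
  unfolding every _==_ linked member fits

  linked-holds : ∀ P a Q b → T (linked-check P a Q b)
  linked-holds = every₄-sound linked-check tt

opaque
  linked-sound : ∀ s t → T (linked s t) →
    ∃₂ λ s₁ s₂ → Step s s₁ × Step s₁ s₂ × Fits s₂ t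
  linked-sound s@(P , a) t@(Q , b) l
    with someStep-sound s (λ s₁ → someStep s₁ λ s₂ → fits s₂ t)
      (⇒ᵇ-elim (linked s t) (linked-holds P a Q b) l)
  ... | s₁ , p , h with someStep-sound s₁ (λ s₂ → fits s₂ t) h
  ... | s₂ , q , f = s₁ , s₂ , p , q , f

thread₃-check : Label → Slot → Label → Slot → Bool
thread₃-check P a Q b = (P == Q ∧ a == b ∧ a == 0F) ∨
  someStep (P , a) λ s₁ → linked s₁ (Q , b)

opaque
  unfolding every _==_ linked member fits

  thread₃-holds : ∀ P a Q b → T (thread₃-check P a Q b)
  thread₃-holds = every₄-sound thread₃-check tt

opaque
  -- `linked` accounts for two of the three vertices, so only the first one has to be searched for.
  thread₃ : ∀ s t → s ≢ t ⊎ proj₂ s ≢ 0F →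
    ∃₂ λ s₁ s₂ → ∃ λ s₃ → Step s s₁ × Step s₁ s₂ × Step s₂ s₃ × Fits s₃ t
  thread₃ s@(P , a) t@(Q , b) h
    with ∨-elim (P == Q ∧ a == b ∧ a == 0F) (thread₃-holds P a Q b)
  ... | inj₂ h′ with someStep-sound s (λ s₁ → linked s₁ t) h′
  ... | s₁ , p , l with linked-sound s₁ t l
  ... | s₂ , s₃ , q , r , f = s₁ , s₂ , s₃ , p , q , r , f
  thread₃ s@(P , a) t@(Q , b) h | inj₁ eq = ⊥-elim (contra h)
    where
    e₁ : P ≡ Q
    e₁ = ==-sound (proj₁ (∧-elim (P == Q) eq))
    e₂ : T (a == b ∧ a == 0F)
    e₂ = proj₂ (∧-elim (P == Q) eq)
    contra : ¬ (s ≢ t ⊎ a ≢ 0F)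
    contra (inj₁ n) = n (cong₂ _,_ e₁ (==-sound (proj₁ (∧-elim (a == b) e₂))))
    contra (inj₂ n) = n (==-sound (proj₂ (∧-elim (a == b) e₂)))

-- A vertex whose slot  proj₂ t  faces the chain still to be coloured, whose
-- slot  b  faces the coloured chain, and whose remaining neighbour has state  y.
branch-ok : Label → Label → State → State → Slot → Bool
branch-ok P Q y t@(R , r) b = not (b == r) ∧ fits y (R , third r b) ∧
  some λ j → linked (member P Q j) (R , b)

branch-check : Label → Label → Label → Slot → Bool
branch-check P Q Y y = some λ P′ → some λ Q′ → every λ i → some (branch-ok P Q (Y , y) (member P′ Q′ i))

opaque
  unfolding every _==_ linked member fits

  branch-holds : ∀ P Q Y y → T (branch-check P Q Y y)
  branch-holds = every₄-sound branch-check tt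

opaque
  -- Three options survive a block: the new family may depend on the old one and on `y`, and each of
  -- its states is reached from some old option `j`, which may vary with `i`.
  branch-step : ∀ P Q y → ∃₂ λ P′ Q′ → ∀ i →
    ∃ λ j → ∃₂ λ s₁ s₂ → ∃ λ b →
    Step (member P Q j) s₁ × Step s₁ s₂ ×
    b ≢ proj₂ (member P′ Q′ i) × Fits s₂ (proj₁ (member P′ Q′ i) , b) ×
    Fits y (proj₁ (member P′ Q′ i) , third (proj₂ (member P′ Q′ i)) b)
  branch-step P Q y with some₂-sound (λ P′ Q′ → every λ i → some (branch-ok P Q y (member P′ Q′ i)))
                           (branch-holds P Q (proj₁ y) (proj₂ y))
  ... | P′ , Q′ , h = P′ , Q′ , λ i →
    decode (member P′ Q′ i) (every-sound (λ i → some (branch-ok P Q y (member P′ Q′ i))) h i)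
    where
    decode : ∀ t → T (some (branch-ok P Q y t)) → ∃ λ j → ∃₂ λ s₁ s₂ → ∃ λ b →
      Step (member P Q j) s₁ × Step s₁ s₂ ×
      b ≢ proj₂ t × Fits s₂ (proj₁ t , b) × Fits y (proj₁ t , third (proj₂ t) b)
    decode t@(R , r) h with some-sound (branch-ok P Q y t) h
    ... | b , h₁ with ∧-elim (not (b == r)) h₁
    ... | d , h₂ with ∧-elim (fits y (R , third r b)) h₂
    ... | f , h₃ with some-sound (λ j → linked (member P Q j) (R , b)) h₃
    ... | j , l with linked-sound (member P Q j) (R , b) l
    ... | s₁ , s₂ , p , q , g = j , s₁ , s₂ , b , p , q , /=-sound d , g , f

end-ok : State → State → State → Slot → Bool
end-ok y (S , s) (R , r) b =
  not (b == r) ∧ fits y (R , third r b) ∧ (not (b == 0F) ∨ (R == S ∧ b == s))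

end-check : Label → Slot → Bool
end-check Y y = some λ P → some λ Q → some λ S → some λ s → every λ i → some (end-ok (Y , y) (S , s) (member P Q i))

opaque
  unfolding every _==_ linked member fits

  end-holds : ∀ Y y → T (end-check Y y)
  end-holds = every₂-sound end-check tt

opaque
  -- The slot `b` goes to the port facing neither the chain nor the coloured neighbour. If the cycle
  -- closes at this vertex, that port faces the thread, so `b` is kept nonzero or the resulting
  -- state equals one `s` common to all three options.
  end-step : ∀ y → ∃₂ λ P Q → ∃ λ s → ∀ i → ∃ λ b →
    b ≢ proj₂ (member P Q i) ×
    Fits y (proj₁ (member P Q i) , third (proj₂ (member P Q i)) b) ×
    (b ≢ 0F ⊎ (proj₁ (member P Q i) , b) ≡ s)
  end-step y
    with some₂-sound (λ P Q → some λ S → some λ s → every λ i → some (end-ok y (S , s) (member P Q i)))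
      (end-holds (proj₁ y) (proj₂ y))
  ... | P , Q , h with some₂-sound (λ S s → every λ i → some (end-ok y (S , s) (member P Q i))) h
  ... | S , s , h′ = P , Q , (S , s) , λ i →
    decode (member P Q i) (every-sound (λ i → some (end-ok y (S , s) (member P Q i))) h′ i)
    where
    good : ∀ R b → T (not (b == 0F) ∨ (R == S ∧ b == s)) → b ≢ 0F ⊎ (R , b) ≡ (S , s)
    good R b h with ∨-elim (not (b == 0F)) h
    ... | inj₁ n = inj₁ (/=-sound n)
    ... | inj₂ e = inj₂ (cong₂ _,_ (==-sound (proj₁ (∧-elim (R == S) e))) (==-sound (proj₂ (∧-elim (R == S) e))))
    decode : ∀ t → T (some (end-ok y (S , s) t)) → ∃ λ b →
      b ≢ proj₂ t × Fits y (proj₁ t , third (proj₂ t) b) × (b ≢ 0F ⊎ (proj₁ t , b) ≡ (S , s))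
    decode t@(R , r) h with some-sound (end-ok y (S , s) t) h
    ... | b , h₁ with ∧-elim (not (b == r)) h₁
    ... | d , h₂ with ∧-elim (fits y (R , third r b)) h₂
    ... | f , h₃ = b , /=-sound d , f , good R b h₃

avoids : State → State → Bool
avoids (R , r) (S , s) = not (R == S) ∨ not (r == s) ∨ not (r == 0F)

avoids-sound : ∀ t s → T (avoids t s) → t ≢ s ⊎ proj₂ t ≢ 0F
avoids-sound (R , r) (S , s) h with ∨-elim (not (R == S)) h
... | inj₁ n = inj₁ λ eq → /=-sound n (cong proj₁ eq)
... | inj₂ h′ with ∨-elim (not (r == s)) h′
... | inj₁ n = inj₁ λ eq → /=-sound n (cong proj₂ eq)
... | inj₂ n = inj₂ (/=-sound n)

avoids-check : Label → Label → Label → Slot → Bool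
avoids-check P Q S s = some λ i → avoids (member P Q i) (S , s)

opaque
  unfolding every _==_ linked member fits

  avoids-holds : ∀ P Q S s → T (avoids-check P Q S s)
  avoids-holds = every₄-sound avoids-check tt

opaque
  -- Every family contains a state with a nonzero slot.
  member-avoids : ∀ P Q s → ∃ λ i → member P Q i ≢ s ⊎ proj₂ (member P Q i) ≢ 0F
  member-avoids P Q s
    with some-sound (λ i → avoids (member P Q i) s)
      (avoids-holds P Q (proj₁ s) (proj₂ s))
  ... | i , h = i , avoids-sound (member P Q i) s h

fits-sym-check : Label → Slot → Label → Slot → Bool
fits-sym-check P a Q b = fits (P , a) (Q , b) ⇒ᵇ fits (Q , b) (P , a)

opaque
  unfolding every _==_ linked member fits

  fits-sym-holds : ∀ P a Q b → T (fits-sym-check P a Q b)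
  fits-sym-holds = every₄-sound fits-sym-check tt

fits-sym : ∀ s t → Fits s t → Fits t s
fits-sym s@(P , a) t@(Q , b) = ⇒ᵇ-elim (fits s t) (fits-sym-holds P a Q b)

fitting-check : Label → Slot → Bool
fitting-check P a = some λ Q → some λ b → fits (P , a) (Q , b)

opaque
  unfolding every _==_ linked member fits

  fitting-holds : ∀ P a → T (fitting-check P a)
  fitting-holds = every₂-sound fitting-check tt

opaque
  -- Slot 0 of `P` is met by slot 0 of the complement of `P`; a positive colour is met by another
  -- label containing it.
  fitting : ∀ s → ∃ (Fits s)
  fitting s with some₂-sound (λ Q b → fits s (Q , b)) (fitting-holds (proj₁ s) (proj₂ s))
  ... | Q , b , f = (Q , b) , f

fits-colour-check : Label → Slot → Label → Slot → Bool
fits-colour-check P a Q b = fits (P , a) (Q , b) ⇒ᵇ (colourOf (P , a) == colourOf (Q , b))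

opaque
  unfolding every _==_ linked member fits

  fits-colour-holds : ∀ P a Q b → T (fits-colour-check P a Q b)
  fits-colour-holds = every₄-sound fits-colour-check tt

fits-colour : ∀ s t → Fits s t → colourOf s ≡ colourOf t
fits-colour s@(P , a) t@(Q , b) f =
  ==-sound (⇒ᵇ-elim (fits s t) (fits-colour-holds P a Q b) f)

==-complete : ∀ {n} {i j : Fin n} → i ≡ j → T (i == j)
==-complete refl = ==-refl _

injective-check : Label → Bool
injective-check P = every λ a → every λ b → colourOf (P , a) == colourOf (P , b) ⇒ᵇ a == b

opaque
  unfolding every _==_ linked member fits

  injective-holds : ∀ P → T (injective-check P)
  injective-holds = every-sound injective-check tt

colourOf-injective : ∀ P a b → colourOf (P , a) ≡ colourOf (P , b) → a ≡ b
colourOf-injective P a b eq =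
  ==-sound (⇒ᵇ-elim (colourOf (P , a) == colourOf (P , b))
    (every₂-sound (λ a b → colourOf (P , a) == colourOf (P , b) ⇒ᵇ a == b)
       (injective-holds P) a b) (==-complete eq))

shared-check : Label → Slot → Label → Slot → Bool
shared-check P p Q q = fits (P , p) (Q , q) ⇒ᵇ
  (every λ a → every λ b → colourOf (P , suc a) == colourOf (Q , suc b) ⇒ᵇ p == suc a)

opaque
  unfolding every _==_ linked member fits

  shared-holds : ∀ P p Q q → T (shared-check P p Q q)
  shared-holds = every₄-sound shared-check tt

-- Complementary labels share nothing, and two different intersecting pairs share exactly one
-- colour, which is that of the edge. This is what makes the four positive classes induced
-- matchings.
fits-shared : ∀ s t → Fits s t → ∀ a b →
  colourOf (proj₁ s , suc a) ≡ colourOf (proj₁ t , suc b) → proj₂ s ≡ suc a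
fits-shared s@(P , p) t@(Q , q) f a b eq =
  ==-sound (⇒ᵇ-elim (colourOf (P , suc a) == colourOf (Q , suc b))
    (every₂-sound (λ a b → colourOf (P , suc a) == colourOf (Q , suc b) ⇒ᵇ p == suc a)
      (⇒ᵇ-elim (fits s t) (shared-holds P p Q q) f) a b)
    (==-complete eq))

-- Two values determine a bijection between three ports and three slots, so two slots suffice to
-- specify a star.
arrange : Fin 3 → Slot → Fin 3 → Slot → Fin 3 → Slot
arrange i a j b k = if does (k ≟ i) then a else if does (k ≟ j) then b else third a b

arrange-check : Fin 3 → Fin 3 → Slot → Slot → Bool
arrange-check i j a b = not (i == j) ⇒ᵇ (not (a == b) ⇒ᵇ
  every λ k → every λ l → arrange i a j b k == arrange i a j b l ⇒ᵇ k == l)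

opaque
  unfolding every _==_ linked member fits

  arrange-holds : ∀ i j a b → T (arrange-check i j a b)
  arrange-holds = every₄-sound arrange-check tt

arrange-injective : ∀ {i a j b} → i ≢ j → a ≢ b → ∀ {k l} →
  arrange i a j b k ≡ arrange i a j b l → k ≡ l
arrange-injective {i} {a} {j} {b} i≢j a≢b {k} {l} eq =
  ==-sound (⇒ᵇ-elim (arrange i a j b k == arrange i a j b l)
    (every₂-sound (λ k l → arrange i a j b k == arrange i a j b l ⇒ᵇ k == l)
      (⇒ᵇ-elim (not (a == b))
        (⇒ᵇ-elim (not (i == j)) (arrange-holds i j a b) (/=-complete i≢j))
        (/=-complete a≢b)) k l)
    (==-complete eq))

arrange-first : ∀ i a j b → arrange i a j b i ≡ a
arrange-first i a j b with i ≟ i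
... | yes _ = refl
... | no ¬p = ⊥-elim (¬p refl)

arrange-second : ∀ {i} a {j} b → i ≢ j → arrange i a j b j ≡ b
arrange-second {i} a {j} b i≢j with j ≟ i
... | yes p = ⊥-elim (i≢j (sym p))
... | no _ with j ≟ j
...   | yes _ = refl
...   | no ¬p = ⊥-elim (¬p refl)

arrange-third : ∀ {i} a {j} b {k} → k ≢ i → k ≢ j → arrange i a j b k ≡ third a b
arrange-third {i} a {j} b {k} k≢i k≢j with k ≟ i
... | yes p = ⊥-elim (k≢i p)
... | no _ with k ≟ j
...   | yes p = ⊥-elim (k≢j p)
...   | no _ = refl

-- Finite sums and partitions

∑ : ∀ {n} → (Fin n → ℕ) → ℕ
∑ = sum

[_] : Bool → ℕ
[ true ]  = 1
[ false ] = 0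

T⇒[]≡1 : ∀ {b} → T b → [ b ] ≡ 1
T⇒[]≡1 {true} _ = refl

¬T⇒[]≡0 : ∀ {b} → ¬ T b → [ b ] ≡ 0
¬T⇒[]≡0 {true}  h = ⊥-elim (h tt)
¬T⇒[]≡0 {false} _ = refl

[]-mono : ∀ {b c} → (T b → T c) → [ b ] ≤ [ c ]
[]-mono {false} _ = z≤n
[]-mono {true} h = ≤-reflexive (sym (T⇒[]≡1 (h tt)))

δ : ∀ {n} → Fin n → Fin n → ℕ
δ i j = [ does (i ≟ j) ]

δ-refl : ∀ {n} (i : Fin n) → δ i i ≡ 1
δ-refl i = cong [_] (dec-true (i ≟ i) refl)

δ-≡ : ∀ {n} {i j : Fin n} → i ≡ j → δ i j ≡ 1
δ-≡ {i = i} refl = δ-refl i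

δ-≢ : ∀ {n} {i j : Fin n} → i ≢ j → δ i j ≡ 0
δ-≢ {i = i} {j} h = cong [_] (dec-false (i ≟ j) h)

∑-mono : ∀ {n} {f g : Fin n → ℕ} → (∀ i → f i ≤ g i) → ∑ f ≤ ∑ g
∑-mono {zero}  h = z≤n
∑-mono {suc n} h = +-mono-≤ (h zero) (∑-mono (h ∘ suc))

∑-zero : ∀ {n} {f : Fin n → ℕ} → (∀ i → f i ≡ 0) → ∑ f ≡ 0
∑-zero {zero}  h = refl
∑-zero {suc n} h = cong₂ _+_ (h zero) (∑-zero (h ∘ suc))

∑-const : ∀ n c → ∑ {n} (λ _ → c) ≡ n * c
∑-const zero    c = refl
∑-const (suc n) c = cong (c +_) (∑-const n c)

∑-*ˡ : ∀ {n} c (f : Fin n → ℕ) → ∑ (λ i → c * f i) ≡ c * ∑ f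
∑-*ˡ {zero}  c f = sym (*-zeroʳ c)
∑-*ˡ {suc n} c f = trans (cong (c * f zero +_) (∑-*ˡ c (f ∘ suc))) (sym (*-distribˡ-+ c _ _))

term≤∑ : ∀ {n} (f : Fin n → ℕ) i → f i ≤ ∑ f
term≤∑ f zero    = m≤m+n _ _
term≤∑ f (suc i) = ≤-trans (term≤∑ (f ∘ suc) i) (m≤n+m _ _)

∑-δ : ∀ {n} (i : Fin n) (f : Fin n → ℕ) → ∑ (λ j → δ i j * f j) ≡ f i
∑-δ {suc n} zero f = trans (cong₂ _+_ (+-identityʳ (f zero)) (∑-zero {n} λ _ → refl)) (+-identityʳ _)
∑-δ {suc n} (suc i) f = trans (sum-cong-≗ λ j → cong (_* f (suc j)) (eq j)) (∑-δ i (f ∘ suc))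
  where
  eq : ∀ j → δ (suc i) (suc j) ≡ δ i j
  eq j with i ≟ j
  ... | yes _ = refl
  ... | no _  = refl

∑-δ1 : ∀ {n} (i : Fin n) → ∑ (δ i) ≡ 1
∑-δ1 i = trans (sum-cong-≗ λ j → sym (*-identityʳ (δ i j))) (∑-δ i (λ _ → 1))

-- Isolates the contribution of one edge in an equality between total flows.
∑-single-≡ : ∀ {n} {f g : Fin n → ℕ} (i : Fin n) → ∑ f ≡ ∑ g →
  (∀ j → j ≢ i → f j ≡ g j) → f i ≡ g i
∑-single-≡ {f = f} {g} zero eq h = +-cancelʳ-≡ _ _ _
  (trans eq (cong (g zero +_) (sym (sum-cong-≗ λ j → h (suc j) λ ()))))
∑-single-≡ {f = f} {g} (suc i) eq h = ∑-single-≡ i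
  (+-cancelˡ-≡ (f zero) _ _ (trans eq (cong (_+ ∑ (g ∘ suc)) (sym (h zero λ ())))))
  (λ j j≢i → h (suc j) (j≢i ∘ suc-injective))

∑-positive : ∀ {n} (f : Fin n → ℕ) → 1 ≤ ∑ f → ∃ λ i → 1 ≤ f i
∑-positive {suc n} f h with f zero in eq
... | suc m = zero , subst (1 ≤_) (sym eq) (s≤s z≤n)
... | zero with ∑-positive (f ∘ suc) h
...   | i , p = suc i , p

-- After exchanging the sums, injectivity leaves at most one `i` with `p i` above each `j`, and
-- where there is one, `q j` is at least 1.
∑-injective : ∀ {m n} (p : Fin m → Bool) (q : Fin n → ℕ) (f : Fin m → Fin n) →
  (∀ i j → T (p i) → T (p j) → f i ≡ f j → i ≡ j) →
  (∀ i → T (p i) → 1 ≤ q (f i)) →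
  ∑ (λ i → [ p i ]) ≤ ∑ q
∑-injective p q f inj h = begin
  ∑ (λ i → [ p i ])                          ≡⟨ sum-cong-≗ (λ i → sym (∑-δ (f i) (λ _ → [ p i ]))) ⟩
  ∑ (λ i → ∑ (λ j → δ (f i) j * [ p i ]))    ≡⟨ ∑-comm (λ i j → δ (f i) j * [ p i ]) ⟩
  ∑ (λ j → ∑ (λ i → δ (f i) j * [ p i ]))    ≤⟨ ∑-mono column ⟩
  ∑ q                                        ∎
  where
  open ≤-Reasoning
  row : ∀ j i → T (p i) → f i ≡ j → ∀ k → δ (f k) j * [ p k ] ≤ δ i k * 1
  row j i pi eq k with p k in pk
  ... | false = ≤-trans (≤-reflexive (*-zeroʳ (δ (f k) j))) z≤n
  ... | true with f k ≟ j
  ...   | no ¬e = z≤n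
  ...   | yes e = ≤-reflexive (sym (trans (*-identityʳ (δ i k)) (δ-≡ (inj i k pi (subst T (sym pk) tt) (trans eq (sym e))))))
  column : ∀ j → ∑ (λ i → δ (f i) j * [ p i ]) ≤ q j
  column j with ∑ (λ i → δ (f i) j * [ p i ]) in eq
  ... | zero = z≤n
  ... | suc m with ∑-positive (λ i → δ (f i) j * [ p i ]) (subst (1 ≤_) (sym eq) (s≤s z≤n))
  ...   | i , h₁ with p i in pi | f i ≟ j
  ...     | false | w = ⊥-elim (1+n≰n (≤-trans h₁ (≤-reflexive (*-zeroʳ [ does w ]))))
  ...     | true | no ¬e = ⊥-elim (1+n≰n (≤-trans h₁ z≤n))
  ...     | true | yes e = ≤-trans (≤-reflexive (sym eq)) (≤-trans
    (∑-mono (row j i (subst T (sym pi) tt) e))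
    (≤-trans (≤-reflexive (∑-δ i (λ _ → 1))) (subst (λ x → 1 ≤ q x) e (h i (subst T (sym pi) tt)))))

-- Partitions of  Fin N  are represented by idempotent maps; merging two
-- classes destroys at most one fixed point.
merge : ∀ {N} → (Fin N → Fin N) → Fin N → Fin N → Fin N → Fin N
merge r a b x = if does (r x ≟ r a) then r b else r x

Idempotent : ∀ {N} → (Fin N → Fin N) → Set
Idempotent r = ∀ x → r (r x) ≡ r x

fixed : ∀ {N} → (Fin N → Fin N) → Fin N → Bool
fixed r x = does (r x ≟ x)

merge-idempotent : ∀ {N} (r : Fin N → Fin N) a b → Idempotent r → Idempotent (merge r a b)
merge-idempotent r a b idem x with r x ≟ r a
... | yes _ with r (r b) ≟ r a
...   | yes _ = refl
...   | no _  = idem b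
merge-idempotent r a b idem x | no ¬e with r (r x) ≟ r a
...   | yes e = ⊥-elim (¬e (trans (sym (idem x)) e))
...   | no _  = idem x

merge-respects : ∀ {N} (r : Fin N → Fin N) a b {x y} → r x ≡ r y → merge r a b x ≡ merge r a b y
merge-respects r a b {x} {y} e rewrite e = refl

merge-joins : ∀ {N} (r : Fin N → Fin N) a b → merge r a b a ≡ merge r a b b
merge-joins r a b with r a ≟ r a | r b ≟ r a
... | yes _ | yes _ = refl
... | yes _ | no _  = refl
... | no ¬e | _     = ⊥-elim (¬e refl)

merge-trivial : ∀ {N} (r : Fin N → Fin N) a b → r a ≡ r b → ∀ x → merge r a b x ≡ r x
merge-trivial r a b e x with r x ≟ r a
... | yes e′ = trans (sym e) (sym e′)
... | no _   = refl

fixedPoints : ∀ {N} → (Fin N → Fin N) → ℕ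
fixedPoints r = ∑ (λ x → [ fixed r x ])

merge-fixedPoints : ∀ {N} (r : Fin N → Fin N) a b → Idempotent r →
  fixedPoints r ≤ fixedPoints (merge r a b) + [ not (does (r a ≟ r b)) ]
merge-fixedPoints {N} r a b idem with r a ≟ r b
... | yes e = ≤-trans (≤-reflexive (sum-cong-≗ λ x →
      cong (λ y → [ does (y ≟ x) ]) (sym (merge-trivial r a b e x)))) (m≤m+n _ 0)
... | no _ = begin
    fixedPoints r                                                    ≤⟨ ∑-mono pointwise ⟩
    ∑ (λ x → [ fixed (merge r a b) x ] + δ (r a) x)                  ≡⟨ ∑-distrib-+ (λ x → [ fixed (merge r a b) x ]) (δ (r a)) ⟩
    fixedPoints (merge r a b) + ∑ (δ (r a))                          ≡⟨ cong (fixedPoints (merge r a b) +_) (∑-δ1 (r a)) ⟩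
    fixedPoints (merge r a b) + 1                                    ∎
    where
    open ≤-Reasoning
    pointwise : ∀ x → [ fixed r x ] ≤ [ fixed (merge r a b) x ] + δ (r a) x
    pointwise x with r x ≟ x
    ... | no _ = z≤n
    ... | yes e with r x ≟ r a
    ...   | yes e′ = ≤-trans (≤-reflexive (sym (δ-≡ (trans (sym e′) e)))) (m≤n+m _ _)
    ...   | no _ = ≤-trans (≤-reflexive (sym (δ-≡ e))) (m≤m+n _ _)

-- The edges  e k  with  p k  are merged in order of decreasing index.
mergeAll : ∀ {N M} → (Fin N → Fin N) → (Fin M → Bool) → (Fin M → Fin N × Fin N) → Fin N → Fin N
mergeAll {M = zero}  r p e = r
mergeAll {M = suc M} r p e =
  if p zero then merge (mergeAll r (p ∘ suc) (e ∘ suc)) (proj₁ (e zero)) (proj₂ (e zero))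
            else mergeAll r (p ∘ suc) (e ∘ suc)

mergedAbove : ∀ {N M} → (Fin N → Fin N) → (Fin M → Bool) → (Fin M → Fin N × Fin N) → Fin M → Fin N → Fin N
mergedAbove r p e zero    = mergeAll r (p ∘ suc) (e ∘ suc)
mergedAbove r p e (suc k) = mergedAbove r (p ∘ suc) (e ∘ suc) k

-- Kruskal's rule: a selected edge counts if its ends are still in different classes once all
-- selected edges of larger index have been merged.
effective : ∀ {N M} → (Fin N → Fin N) → (Fin M → Bool) → (Fin M → Fin N × Fin N) → Fin M → Bool
effective r p e k = p k ∧ not (does (mergedAbove r p e k (proj₁ (e k)) ≟ mergedAbove r p e k (proj₂ (e k))))

mergeAll-idempotent : ∀ {N M} (r : Fin N → Fin N) (p : Fin M → Bool) e → Idempotent r → Idempotent (mergeAll r p e)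
mergeAll-idempotent {M = zero}  r p e idem = idem
mergeAll-idempotent {M = suc M} r p e idem with p zero
... | true  = merge-idempotent (mergeAll r (p ∘ suc) (e ∘ suc)) _ _ (mergeAll-idempotent r (p ∘ suc) (e ∘ suc) idem)
... | false = mergeAll-idempotent r (p ∘ suc) (e ∘ suc) idem

mergeAll-respects : ∀ {N M} (r : Fin N → Fin N) (p : Fin M → Bool) e {x y} → r x ≡ r y →
  mergeAll r p e x ≡ mergeAll r p e y
mergeAll-respects {M = zero}  r p e eq = eq
mergeAll-respects {M = suc M} r p e eq with p zero
... | true  = merge-respects (mergeAll r (p ∘ suc) (e ∘ suc)) _ _ (mergeAll-respects r (p ∘ suc) (e ∘ suc) eq)
... | false = mergeAll-respects r (p ∘ suc) (e ∘ suc) eq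

mergeAll-joins : ∀ {N M} (r : Fin N → Fin N) (p : Fin M → Bool) e k → T (p k) →
  mergeAll r p e (proj₁ (e k)) ≡ mergeAll r p e (proj₂ (e k))
mergeAll-joins r p e zero pk with p zero
... | true = merge-joins (mergeAll r (p ∘ suc) (e ∘ suc)) _ _
mergeAll-joins r p e (suc k) pk with p zero
... | true  = merge-respects (mergeAll r (p ∘ suc) (e ∘ suc)) _ _ (mergeAll-joins r (p ∘ suc) (e ∘ suc) k pk)
... | false = mergeAll-joins r (p ∘ suc) (e ∘ suc) k pk

mergedAbove-joins : ∀ {N M} (r : Fin N → Fin N) (p : Fin M → Bool) e {k l} → k <ᶠ l → T (p l) →
  mergedAbove r p e k (proj₁ (e l)) ≡ mergedAbove r p e k (proj₂ (e l))
mergedAbove-joins r p e {zero}  {suc l} _ pl = mergeAll-joins r (p ∘ suc) (e ∘ suc) l pl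
mergedAbove-joins r p e {suc k} {suc l} (s≤s k<l) pl = mergedAbove-joins r (p ∘ suc) (e ∘ suc) k<l pl

mergeAll-fixedPoints : ∀ {N M} (r : Fin N → Fin N) (p : Fin M → Bool) e → Idempotent r →
  fixedPoints r ≤ fixedPoints (mergeAll r p e) + ∑ (λ k → [ effective r p e k ])
mergeAll-fixedPoints {M = zero}  r p e idem = m≤m+n _ 0
mergeAll-fixedPoints {M = suc M} r p e idem = ≤-trans ih step
  where
  r′ = mergeAll r (p ∘ suc) (e ∘ suc)
  rest = ∑ (λ k → [ effective r (p ∘ suc) (e ∘ suc) k ])
  ih = mergeAll-fixedPoints r (p ∘ suc) (e ∘ suc) idem
  step : fixedPoints r′ + rest ≤ fixedPoints (mergeAll r p e) + ([ effective r p e zero ] + rest)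
  step with p zero
  ... | true  = ≤-trans (+-monoˡ-≤ rest (merge-fixedPoints r′ _ _ (mergeAll-idempotent r (p ∘ suc) (e ∘ suc) idem)))
                        (≤-reflexive (+-assoc (fixedPoints (merge r′ _ _)) _ _))
  ... | false = ≤-refl

effective≤ : ∀ {N M} (r : Fin N → Fin N) (p : Fin M → Bool) e k → T (effective r p e k) → T (p k)
effective≤ r p e k h with p k
... | true = tt

all-or-some : ∀ {n} {P : Fin n → Set} {Q : Set} → (∀ i → P i ⊎ Q) → (∀ i → P i) ⊎ Q
all-or-some {zero}  h = inj₁ λ ()
all-or-some {suc n} h with h zero | all-or-some (h ∘ suc)
... | inj₂ q | _      = inj₂ q
... | inj₁ _ | inj₂ q = inj₂ q
... | inj₁ p | inj₁ f = inj₁ λ { zero → p ; (suc i) → f i }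

-- Local colourings

∣tabulate∣ : ∀ {n} (p : Fin n → Bool) → ∣ tabulate p ∣ ≡ ∑ (λ i → [ p i ])
∣tabulate∣ {zero}  p = refl
∣tabulate∣ {suc n} p with p zero
... | true  = cong suc (∣tabulate∣ (p ∘ suc))
... | false = ∣tabulate∣ (p ∘ suc)

rank : ∀ {n} → (Fin n → Bool) → Fin n → ℕ
rank p zero    = 0
rank p (suc i) = [ p zero ] + rank (p ∘ suc) i

rank<∑ : ∀ {n} (p : Fin n → Bool) {i} → T (p i) → rank p i < ∑ (λ j → [ p j ])
rank<∑ p {zero}  pi = ≤-trans (≤-reflexive (sym (T⇒[]≡1 pi))) (m≤m+n [ p zero ] _)
rank<∑ p {suc i} pi = ≤-trans (≤-reflexive (sym (+-suc [ p zero ] _))) (+-monoʳ-≤ [ p zero ] (rank<∑ (p ∘ suc) pi))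

rank-injective : ∀ {n} (p : Fin n → Bool) {i j} → T (p i) → T (p j) → rank p i ≡ rank p j → i ≡ j
rank-injective p {zero}  {zero}  _  _  _  = refl
rank-injective p {suc i} {suc j} pi pj eq =
  cong suc (rank-injective (p ∘ suc) pi pj (+-cancelˡ-≡ [ p zero ] _ _ eq))
rank-injective p {zero}  {suc j} pi pj eq with p zero
rank-injective p {zero}  {suc j} pi pj () | true
rank-injective p {suc i} {zero}  pi pj eq with p zero
rank-injective p {suc i} {zero}  pi pj () | true

clamp : ℕ → Fin 3
clamp 0 = 0F
clamp 1 = 1F
clamp _ = 2F

clamp-injective : ∀ {a b} → a < 3 → b < 3 → clamp a ≡ clamp b → a ≡ b
clamp-injective {0} {0} _ _ _ = refl
clamp-injective {1} {1} _ _ _ = refl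
clamp-injective {2} {2} _ _ _ = refl
clamp-injective {0} {1} _ _ ()
clamp-injective {0} {2} _ _ ()
clamp-injective {1} {0} _ _ ()
clamp-injective {1} {2} _ _ ()
clamp-injective {2} {0} _ _ ()
clamp-injective {2} {1} _ _ ()
clamp-injective {suc (suc (suc _))} (s≤s (s≤s (s≤s ()))) _ _
clamp-injective {0} {suc (suc (suc _))} _ (s≤s (s≤s (s≤s ()))) _
clamp-injective {1} {suc (suc (suc _))} _ (s≤s (s≤s (s≤s ()))) _
clamp-injective {2} {suc (suc (suc _))} _ (s≤s (s≤s (s≤s ()))) _

third-third : ∀ {a b} → a ≢ b → third a (third a b) ≡ b
third-third {0F} {0F} h = ⊥-elim (h refl)
third-third {0F} {1F} h = refl
third-third {0F} {2F} h = refl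
third-third {1F} {0F} h = refl
third-third {1F} {1F} h = ⊥-elim (h refl)
third-third {1F} {2F} h = refl
third-third {2F} {0F} h = refl
third-third {2F} {1F} h = refl
third-third {2F} {2F} h = ⊥-elim (h refl)

third-≢ˡ : ∀ {a b} → a ≢ b → a ≢ third a b
third-≢ˡ {0F} {0F} h _ = h refl
third-≢ˡ {0F} {1F} h ()
third-≢ˡ {0F} {2F} h ()
third-≢ˡ {1F} {0F} h ()
third-≢ˡ {1F} {1F} h _ = h refl
third-≢ˡ {1F} {2F} h ()
third-≢ˡ {2F} {0F} h ()
third-≢ˡ {2F} {1F} h ()
third-≢ˡ {2F} {2F} h _ = h refl

third-≢ʳ : ∀ {a b} → a ≢ b → b ≢ third a b
third-≢ʳ {0F} {0F} h _ = h refl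
third-≢ʳ {0F} {1F} h ()
third-≢ʳ {0F} {2F} h ()
third-≢ʳ {1F} {0F} h ()
third-≢ʳ {1F} {1F} h _ = h refl
third-≢ʳ {1F} {2F} h ()
third-≢ʳ {2F} {0F} h ()
third-≢ʳ {2F} {1F} h ()
third-≢ʳ {2F} {2F} h _ = h refl

only-third : ∀ {i j k l : Fin 3} → i ≢ j → k ≢ i → k ≢ j → l ≢ i → l ≢ j → k ≡ l
only-third {i} {j} i≢j k≢i k≢j l≢i l≢j = trans (sym (is-third i≢j k≢i k≢j)) (is-third i≢j l≢i l≢j)
  where
  is-third : ∀ {i j k} → i ≢ j → k ≢ i → k ≢ j → third i j ≡ k
  is-third {0F} {0F} p q r = ⊥-elim (p refl)
  is-third {0F} {1F} {0F} p q r = ⊥-elim (q refl)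
  is-third {0F} {1F} {1F} p q r = ⊥-elim (r refl)
  is-third {0F} {1F} {2F} p q r = refl
  is-third {0F} {2F} {0F} p q r = ⊥-elim (q refl)
  is-third {0F} {2F} {1F} p q r = refl
  is-third {0F} {2F} {2F} p q r = ⊥-elim (r refl)
  is-third {1F} {0F} {0F} p q r = ⊥-elim (r refl)
  is-third {1F} {0F} {1F} p q r = ⊥-elim (q refl)
  is-third {1F} {0F} {2F} p q r = refl
  is-third {1F} {1F} p q r = ⊥-elim (p refl)
  is-third {1F} {2F} {0F} p q r = refl
  is-third {1F} {2F} {1F} p q r = ⊥-elim (q refl)
  is-third {1F} {2F} {2F} p q r = ⊥-elim (r refl)
  is-third {2F} {0F} {0F} p q r = ⊥-elim (r refl)
  is-third {2F} {0F} {1F} p q r = refl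
  is-third {2F} {0F} {2F} p q r = ⊥-elim (q refl)
  is-third {2F} {1F} {0F} p q r = refl
  is-third {2F} {1F} {1F} p q r = ⊥-elim (r refl)
  is-third {2F} {1F} {2F} p q r = ⊥-elim (q refl)
  is-third {2F} {2F} p q r = ⊥-elim (p refl)

other : Fin 3 → Fin 3
other 0F = 1F
other _  = 0F

other-≢ : ∀ i → i ≢ other i
other-≢ 0F ()
other-≢ 1F ()
other-≢ 2F ()

record Star : Set where
  field
    label     : Label
    slots     : Fin 3 → Slot
    injective : ∀ {i j} → slots i ≡ slots j → i ≡ j

mkStar : Label → ∀ i a j b → i ≢ j → a ≢ b → Star
mkStar P i a j b i≢j a≢b = record
  { label = P ; slots = arrange i a j b ; injective = arrange-injective i≢j a≢b }

adj-symᵀ : ∀ {n} (G : Graph n) {u v} → Adj G u v → Adj G v u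
adj-symᵀ G {u} {v} = subst T (adj-sym G u v)

adj-≢ : ∀ {n} (G : Graph n) {u v} → Adj G u v → u ≢ v
adj-≢ G {u} a refl = subst T (adj-irrefl G u) a

update : ∀ {n} {A : Set} → (Fin n → A) → Fin n → A → Fin n → A
update σ v τ w = if does (w ≟ v) then τ else σ w

update-same : ∀ {n} {A : Set} (σ : Fin n → A) v τ → update σ v τ v ≡ τ
update-same σ v τ with v ≟ v
... | yes _ = refl
... | no h  = ⊥-elim (h refl)

update-other : ∀ {n} {A : Set} (σ : Fin n → A) v τ {w} → w ≢ v → update σ v τ w ≡ σ w
update-other σ v τ {w} w≢v with w ≟ v
... | yes e = ⊥-elim (w≢v e)
... | no _  = refl

module Colouring {n : ℕ} (G : Graph n) (subcubic : Subcubic G) where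

  -- The neighbours of `v` are numbered in increasing order; by subcubicity `clamp` identifies none
  -- of them. Giving slots to ports instead of neighbours makes a star independent of the degree.
  port : Fin n → Fin n → Fin 3
  port v w = clamp (rank (adj G v) w)

  port-injective : ∀ {v w w′} → Adj G v w → Adj G v w′ → port v w ≡ port v w′ → w ≡ w′
  port-injective {v} a a′ eq = rank-injective (adj G v) a a′
    (clamp-injective (bound a) (bound a′) eq)
    where
    bound : ∀ {w} → Adj G v w → rank (adj G v) w < 3
    bound a = ≤-trans (rank<∑ (adj G v) a)
      (subst (_≤ 3) (∣tabulate∣ (adj G v)) (subcubic v))

  port-≢ : ∀ {v w w′} → Adj G v w → Adj G v w′ → w ≢ w′ → port v w ≢ port v w′
  port-≢ a a′ w≢w′ eq = w≢w′ (port-injective a a′ eq)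

  Stars : Set
  Stars = Fin n → Star

  outward : Star → Fin 3 → State
  outward τ i = Star.label τ , Star.slots τ i

  state : Stars → Fin n → Fin n → State
  state σ v w = outward (σ v) (port v w)

  Valid : (Fin n → Bool) → Stars → Set
  Valid W σ = ∀ v w → T (W v) → T (W w) → Adj G v w → Fits (state σ v w) (state σ w v)

  state-update-same : ∀ σ v τ w → state (update σ v τ) v w ≡ outward τ (port v w)
  state-update-same σ v τ w = cong (λ s → outward s (port v w)) (update-same σ v τ)

  state-update-other : ∀ σ v τ {w} x → w ≢ v → state (update σ v τ) w x ≡ state σ w x
  state-update-other σ v τ {w} x w≢v = cong (λ s → outward s (port w x)) (update-other σ v τ w≢v)

  -- Edges away from `v` keep both their states, and by the symmetry of `fits` each edge at `v` is
  -- checked in one direction only.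
  extend : ∀ {W W′ σ} v τ → Valid W σ → ¬ T (W v) →
    (∀ w → T (W′ w) → w ≡ v ⊎ T (W w)) →
    (∀ w → T (W w) → Adj G v w → Fits (outward τ (port v w)) (state σ w v)) →
    Valid W′ (update σ v τ)
  extend {W} {W′} {σ} v τ valid v∉W grow new a b a∈ b∈ ab with grow a a∈ | grow b b∈
  ... | inj₁ refl | inj₁ refl = ⊥-elim (adj-≢ G ab refl)
  ... | inj₁ refl | inj₂ b∈W = subst₂ Fits (sym (state-update-same σ v τ b))
          (sym (state-update-other σ v τ v (λ e → adj-≢ G ab (sym e)))) (new b b∈W ab)
  ... | inj₂ a∈W | inj₁ refl = subst₂ Fits (sym (state-update-other σ v τ v (adj-≢ G ab)))
          (sym (state-update-same σ v τ a)) (fits-sym _ _ (new a a∈W (adj-symᵀ G ab)))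
  ... | inj₂ a∈W | inj₂ b∈W = subst₂ Fits
          (sym (state-update-other σ v τ b (λ { refl → v∉W a∈W })))
          (sym (state-update-other σ v τ a (λ { refl → v∉W b∈W }))) (valid a b a∈W b∈W ab)

  Colourable : (Fin n → Bool) → Set
  Colourable W = ∃ (Valid W)

  SmallerColourable : (Fin n → Bool) → Set
  SmallerColourable X = ∀ W → (∀ w → T (W w) → T (X w)) → (∃ λ x → T (X x) × ¬ T (W x)) → Colourable W

  without : (Fin n → Bool) → Fin n → Fin n → Bool
  without X v w = X w ∧ not (does (w ≟ v))

  without-⊆ : ∀ X v w → T (without X v w) → T (X w)
  without-⊆ X v w h with X w
  ... | true = tt

  without-∌ : ∀ X v → ¬ T (without X v v)
  without-∌ X v h with X v | v ≟ v
  ... | true | no ¬e = ¬e refl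

  without-grow : ∀ X v w → T (X w) → w ≡ v ⊎ T (without X v w)
  without-grow X v w h with X w | w ≟ v
  ... | true | yes e = inj₁ e
  ... | true | no _  = inj₂ tt

  leaf-colourable : ∀ X v → T (X v) → (∀ w w′ → T (X w) → Adj G v w → T (X w′) → Adj G v w′ → w ≡ w′) →
    SmallerColourable X → Colourable X
  leaf-colourable X v v∈X unique smaller = conclude (smaller W (without-⊆ X v) (v , v∈X , without-∌ X v))
    where
    W = without X v
    conclude : Colourable W → Colourable X
    conclude (σ , valid) with any? (λ w → T? (W w) ×-dec T? (adj G v w))
    ... | no none = σ , valid′
      where
      valid′ : Valid X σ
      valid′ a b a∈ b∈ ab with without-grow X v a a∈ | without-grow X v b b∈
      ... | inj₁ refl | inj₁ refl = ⊥-elim (adj-≢ G ab refl)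
      ... | inj₁ refl | inj₂ b∈W = ⊥-elim (none (b , b∈W , ab))
      ... | inj₂ a∈W | inj₁ refl = ⊥-elim (none (a , a∈W , adj-symᵀ G ab))
      ... | inj₂ a∈W | inj₂ b∈W = valid a b a∈W b∈W ab
    ... | yes (y , y∈W , vy) with fitting (state σ y v)
    ...   | (Q , b) , f = update σ v τ , extend v τ valid (without-∌ X v) (without-grow X v) new
      where
      i = port v y
      -- Only the port towards `y` is constrained; `other` merely completes the bijection.
      τ = mkStar Q i b (other i) (other b) (other-≢ i) (other-≢ b)
      new : ∀ w → T (W w) → Adj G v w → Fits (outward τ (port v w)) (state σ w v)
      new w w∈W vw with unique w y (without-⊆ X v w w∈W) vw (without-⊆ X v y y∈W) vy
      ... | refl = fits-sym _ _ (subst (λ s → Fits (state σ y v) (Q , s))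
                     (sym (arrange-first i b (other i) (other b))) f)

-- Extending a colouring around a cycle

-- A cycle unrolled into a periodic sequence, so that stretches running past the starting vertex
-- need no modular indices.
record Ring {n : ℕ} (G : Graph n) (X : Fin n → Bool) (L : ℕ) : Set where
  field
    z        : ℕ → Fin n
    period   : ∀ t → z (L + t) ≡ z t
    distinct : ∀ {a b} → a < b → b < L + a → z a ≢ z b
    link     : ∀ t → Adj G (z t) (z (suc t))
    inside   : ∀ t → T (X (z t))

Thin : ∀ {n} → Graph n → (Fin n → Bool) → Fin n → Fin n → Fin n → Set
Thin G X v a b = ∀ w → T (X w) → Adj G v w → w ≡ a ⊎ w ≡ b

module Chain {n : ℕ} (G : Graph n) (subcubic : Subcubic G) (X : Fin n → Bool) (L : ℕ)
  (ring : Ring G X L) where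

  open Colouring G subcubic
  open Ring ring

  ThinAt : ℕ → Set
  ThinAt k = Thin G X (z (suc k)) (z k) (z (2 + k))

  removed : ℕ → Fin n → Bool
  removed zero    w = false
  removed (suc k) w = removed k w ∨ does (w ≟ z (suc k))

  remaining : ℕ → Fin n → Bool
  remaining k w = X w ∧ not (removed k w)

  remaining-⊆ : ∀ k w → T (remaining k w) → T (X w)
  remaining-⊆ k w h with X w
  ... | true = tt

  remaining-grow : ∀ k w → T (remaining k w) → w ≡ z (suc k) ⊎ T (remaining (suc k) w)
  remaining-grow k w h with X w | removed k w | w ≟ z (suc k)
  ... | true | false | yes e = inj₁ e
  ... | true | false | no _  = inj₂ tt

  removed-at : ∀ {k t} → t < k → T (removed k (z (suc t)))
  removed-at {suc k} {t} (s≤s t≤k) with m≤n⇒m<n∨m≡n t≤k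
  ... | inj₁ t<k with removed k (z (suc t)) | removed-at t<k
  ...   | true | _ = tt
  removed-at {suc k} {t} (s≤s t≤k) | inj₂ refl with removed k (z (suc k)) | z (suc k) ≟ z (suc k)
  ... | true  | _     = tt
  ... | false | yes _ = tt
  ... | false | no h  = ⊥-elim (h refl)

  remaining-∌ : ∀ {k t} → t < k → ¬ T (remaining k (z (suc t)))
  remaining-∌ {k} {t} t<k h with X (z (suc t)) | removed k (z (suc t)) | removed-at t<k
  remaining-∌ {k} {t} t<k () | true  | true | _
  remaining-∌ {k} {t} t<k () | false | true | _

  back : ∀ t → Adj G (z (suc t)) (z t)
  back t = adj-symᵀ G (link t)

  -- Thinness leaves two edges to check. The one to `z (2 + k)` is the given step; the one to `z k`
  -- matters only if `z k` is already coloured, as happens for the last inserted vertex of the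
  -- thread.
  add-thin : ∀ k σ s → 3 ≤ L → ThinAt k → Valid (remaining (suc k)) σ →
    Step (state σ (z (2 + k)) (z (suc k))) s →
    (T (remaining (suc k) (z k)) → Fits s (state σ (z k) (z (suc k)))) →
    ∃ λ τ → Valid (remaining k) (update σ (z (suc k)) τ) ×
            state (update σ (z (suc k)) τ) (z (suc k)) (z k) ≡ s
  add-thin k σ (Q , b) 3≤L thin valid (through a a≢b f) fit =
    τ , extend v τ valid (remaining-∌ ≤-refl) (remaining-grow k) new ,
    trans (state-update-same σ v τ (z k)) (cong (Q ,_) (arrange-second a b i≢j))
    where
    v = z (suc k)
    i = port v (z (2 + k))
    j = port v (z k)
    i≢j : i ≢ j
    i≢j = port-≢ (link (suc k)) (back k)
      (λ e → distinct (s≤s (n≤1+n k)) (+-monoˡ-≤ k 3≤L) (sym e))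
    τ = mkStar Q i a j b i≢j a≢b
    new : ∀ w → T (remaining (suc k) w) → Adj G v w → Fits (outward τ (port v w)) (state σ w v)
    new w w∈ vw with thin w (remaining-⊆ (suc k) w w∈) vw
    ... | inj₁ refl = subst (λ x → Fits (Q , x) (state σ w v)) (sym (arrange-second a b i≢j)) (fit w∈)
    ... | inj₂ refl = subst (λ x → Fits (Q , x) (state σ w v)) (sym (arrange-first i a j b)) (fits-sym _ _ f)

  -- The thread fails only between equal states with slot 0. If the cycle closes, the state leaving
  -- `z 0` varies with the option, so it is required to have a nonzero slot or to be the one state
  -- `s` that will be avoided.
  SafeStart : Stars → State → Set
  SafeStart σ s = proj₂ (state σ (z 0) (z 1)) ≢ 0F ⊎ state σ (z 0) (z 1) ≡ s

  -- Everything outside  z 1, …, z k  is coloured, with three options for the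
  -- state of the dart from  z (suc k)  to  z k;  the options differ from  base
  -- only on  z (suc k), …, z end.
  record Reach (k : ℕ) : Set where
    field
      P Q    : Label
      s      : State
      base   : Stars
      end    : ℕ
      end≤16 : end ≤ 16
      k<end  : k < end
      option : ∀ i → ∃ λ σ → Valid (remaining k) σ × state σ (z (suc k)) (z k) ≡ member P Q i ×
               SafeStart σ s × (∀ w → (∀ t → k < t → t ≤ end → w ≢ z t) → σ w ≡ base w)

  close-ring : 5 ≤ L → ThinAt 0 → ThinAt 1 → ThinAt 2 → Reach 3 → Colourable X
  close-ring 5≤L thin₀ thin₁ thin₂ reach = pick (member-avoids P Q s)
    where
    open Reach reach
    3≤L : 3 ≤ L
    3≤L = ≤-trans (m≤n+m 3 2) 5≤L
    apart : ∀ {t} → 0 < t → t < 5 → z 0 ≢ z t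
    apart 0<t t<5 = distinct 0<t (≤-trans t<5 (≤-trans 5≤L (m≤m+n L 0)))
    pick : (∃ λ i → member P Q i ≢ s ⊎ proj₂ (member P Q i) ≢ 0F) → Colourable X
    pick (i , avoid) with option i
    ... | σ , valid , at , safe , _ = insert (thread₃ (state σ (z 4) (z 3)) s′ (compatible avoid safe))
      where
      s′ = state σ (z 0) (z 1)
      t′ = state σ (z 4) (z 3)
      compatible : member P Q i ≢ s ⊎ proj₂ (member P Q i) ≢ 0F → SafeStart σ s → t′ ≢ s′ ⊎ proj₂ t′ ≢ 0F
      compatible (inj₂ h) _ = inj₂ (subst (λ x → proj₂ x ≢ 0F) (sym at) h)
      compatible (inj₁ h) (inj₂ e) = inj₁ λ e′ → h (trans (sym at) (trans e′ e))
      compatible (inj₁ h) (inj₁ h′) with proj₂ t′ ≟ 0F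
      -- The state leaving `z 0` has a nonzero slot here, so slot 0 in `t′` already tells the two
      -- states apart.
      ... | no h″ = inj₂ h″
      ... | yes e = inj₁ λ e′ → h′ (trans (cong proj₂ (sym e′)) e)
      insert : (∃₂ λ s₁ s₂ → ∃ λ s₃ → Step t′ s₁ × Step s₁ s₂ × Step s₂ s₃ × Fits s₃ s′) → Colourable X
      insert (s₁ , s₂ , s₃ , p₁ , p₂ , p₃ , f)
        with add-thin 2 σ s₁ 3≤L thin₂ valid p₁ (λ h → ⊥-elim (remaining-∌ {3} {1} (s≤s (s≤s z≤n)) h))
      ... | τ₁ , valid₁ , at₁
        with add-thin 1 (update σ (z 3) τ₁) s₂ 3≤L thin₁ valid₁ (subst (λ x → Step x s₂) (sym at₁) p₂)
               (λ h → ⊥-elim (remaining-∌ {2} {0} (s≤s z≤n) h))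
      ... | τ₂ , valid₂ , at₂
        with add-thin 0 (update (update σ (z 3) τ₁) (z 2) τ₂) s₃ 3≤L thin₀ valid₂
               (subst (λ x → Step x s₃) (sym at₂) p₃)
               (λ _ → subst (Fits s₃) (sym (trans
                  (state-update-other (update σ (z 3) τ₁) (z 2) τ₂ (z 1) (apart (s≤s z≤n) (s≤s (s≤s (s≤s z≤n)))))
                  (state-update-other σ (z 3) τ₁ (z 1) (apart (s≤s z≤n) (s≤s (s≤s (s≤s (s≤s z≤n)))))))) f)
      ... | τ₃ , valid₃ , _ = update (update (update σ (z 3) τ₁) (z 2) τ₂) (z 1) τ₃ , λ a b a∈ b∈ → valid₃ a b (whole a a∈) (whole b b∈)
        where
        whole : ∀ a → T (X a) → T (remaining 0 a)
        whole a h with X a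
        ... | true = tt

  reach-end : ∀ k → 2 ≤ k → suc k ≤ 16 → suc k ≤ L → SmallerColourable X →
    (∀ w w′ → T (remaining (suc k) w) → Adj G (z (suc k)) w →
              T (remaining (suc k) w′) → Adj G (z (suc k)) w′ → w ≡ w′) →
    Reach k
  reach-end k@(suc k′) 2≤k k<16 k<L smaller unique = conclude
    (smaller (remaining (suc k)) (remaining-⊆ (suc k)) (v , inside (suc k) , remaining-∌ {suc k} ≤-refl))
    where
    v = z (suc k)
    e = port v (z k)
    -- If `suc k` equals `L`, the end vertex `v` is `z 0` itself, and its port towards `z 1` faces
    -- the thread still to be inserted.
    Position : Set
    Position = z 0 ≢ v ⊎ (z 0 ≡ v × Adj G v (z 1) × port v (z 1) ≢ e)
    position : Position
    position with m≤n⇒m<n∨m≡n k<L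
    ... | inj₁ k<L = inj₁ (distinct (s≤s z≤n) (≤-trans k<L (m≤m+n L 0)))
    ... | inj₂ refl = inj₂ (e₀ , start , port-≢ start (back k)
            (distinct 2≤k (≤-trans k<L (m≤m+n L 1))))
      where
      e₀ : z 0 ≡ v
      e₀ = trans (sym (period 0)) (cong z (+-identityʳ L))
      start : Adj G v (z 1)
      start = subst (λ x → Adj G x (z 1)) e₀ (link 0)
    build : ∀ σ → Valid (remaining (suc k)) σ → ∀ i y → i ≢ e →
      (∀ w → T (remaining (suc k) w) → Adj G v w → port v w ≡ i × state σ w v ≡ y) →
      (z 0 ≡ v → Adj G v (z 1) → port v (z 1) ≢ i) → Reach k
    build σ valid i y i≢e nbr start≢i with end-step y
    ... | P , Q , s , choose = record
      { P = P ; Q = Q ; s = base-state position ; base = σ ; end = suc k ; end≤16 = k<16 ; k<end = ≤-refl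
      ; option = λ m → option (member P Q m) (choose m) }
      where
      base-state : Position → State
      base-state (inj₁ _) = state σ (z 0) (z 1)
      base-state (inj₂ _) = s
      option : ∀ t → (∃ λ b → b ≢ proj₂ t × Fits y (proj₁ t , third (proj₂ t) b) × (b ≢ 0F ⊎ (proj₁ t , b) ≡ s)) →
        ∃ λ σ′ → Valid (remaining k) σ′ × state σ′ v (z k) ≡ t ×
               SafeStart σ′ (base-state position) × (∀ w → (∀ t → k < t → t ≤ suc k → w ≢ z t) → σ′ w ≡ σ w)
      option (R , r) (b , b≢r , f , good) =
        update σ v τ , extend v τ valid (remaining-∌ {suc k} ≤-refl) (remaining-grow k) new ,
        trans (state-update-same σ v τ (z k)) (cong (R ,_) (arrange-first e r i (third r b))) ,
        safe position , λ w avoid → update-other σ v τ (avoid (suc k) ≤-refl ≤-refl)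
        where
        r≢b : r ≢ b
        r≢b h = b≢r (sym h)
        τ = mkStar R e r i (third r b) (λ h → i≢e (sym h)) (third-≢ˡ r≢b)
        new : ∀ w → T (remaining (suc k) w) → Adj G v w → Fits (outward τ (port v w)) (state σ w v)
        new w w∈ vw with nbr w w∈ vw
        ... | p , q = subst₂ (λ x u → Fits (R , x) u)
          (sym (trans (cong (arrange e r i (third r b)) p) (arrange-second r (third r b) (λ h → i≢e (sym h)))))
          (sym q) (fits-sym _ _ f)
        safe : ∀ p → SafeStart (update σ v τ) (base-state p)
        safe (inj₁ far) = inj₂ (state-update-other σ v τ (z 1) far)
        safe (inj₂ (e₀ , start , start≢e)) = map
            (λ h h′ → h (trans (sym (cong proj₂ at)) h′)) (trans at) good
          where
          at : state (update σ v τ) (z 0) (z 1) ≡ (R , b)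
          at = trans (cong (λ x → state (update σ v τ) x (z 1)) e₀)
            (trans (state-update-same σ v τ (z 1))
              (cong (R ,_) (trans (arrange-third r (third r b) start≢e (start≢i e₀ start)) (third-third r≢b))))
    spare : Position → ∃ λ i → i ≢ e × (z 0 ≡ v → Adj G v (z 1) → port v (z 1) ≢ i)
    spare (inj₁ far) = other e , (λ h → other-≢ e (sym h)) , λ e₀ → ⊥-elim (far e₀)
    spare (inj₂ (_ , _ , start≢e)) = third e (port v (z 1)) ,
      (λ h → third-≢ˡ (λ h → start≢e (sym h)) (sym h)) , λ _ _ → third-≢ʳ (λ h → start≢e (sym h))
    conclude : Colourable (remaining (suc k)) → Reach k
    conclude (σ , valid) with any? (λ w → T? (remaining (suc k) w) ×-dec T? (adj G v w))
    ... | yes (y , y∈ , vy) = build σ valid (port v y) (state σ y v)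
      (port-≢ vy (back k) (λ { refl → remaining-∌ {suc k} {k′} (s≤s (n≤1+n k′)) y∈ }))
      (λ w w∈ vw → cong (port v) (unique w y w∈ vw y∈ vy) , cong (λ x → state σ x v) (unique w y w∈ vw y∈ vy))
      (λ _ start → port-≢ start vy (λ { refl → remaining-∌ {suc k} {0} (s≤s z≤n) y∈ }))
    -- Without a coloured neighbour any state serves as `y`, and any port that faces neither the
    -- chain nor the thread serves as `i`.
    ... | no none with spare position
    ...   | i , i≢e , start≢i = build σ valid i (0F , 0F) i≢e (λ w w∈ vw → ⊥-elim (none (w , w∈ , vw))) start≢i

  -- By the absence of chords, a third neighbour of `z (suc k)` lies off the part of the chain where
  -- the options differ. Its state is therefore the same `y` for all options, as `branch-step`
  -- requires.
  reach-branch : ∀ k → 1 ≤ k → 3 + k < L → (∀ a b → 2 + a ≤ b → b ≤ 14 + a → ¬ Adj G (z a) (z b)) →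
    ThinAt (1 + k) → ThinAt (2 + k) → Reach (3 + k) → Reach k
  reach-branch k@(suc k′) 1≤k k<L chordless thin₁ thin₂ reach = conclude
    (any? (λ w → T? (remaining (suc k) w) ×-dec (T? (adj G v w) ×-dec ¬? (w ≟ z (2 + k)))))
    where
    open Reach reach
    v = z (suc k)
    p = port v (z k)
    q = port v (z (2 + k))
    3≤L : 3 ≤ L
    3≤L = ≤-trans (m≤m+n 3 (suc k)) k<L
    q≢p : q ≢ p
    q≢p = port-≢ (link (suc k)) (back k) (λ h → distinct (s≤s (n≤1+n k)) (+-monoˡ-≤ k 3≤L) (sym h))
    z0≢ : ∀ t → 0 < t → t ≤ 3 + k → z 0 ≢ z t
    z0≢ t 0<t t≤ = distinct 0<t (≤-trans (s≤s t≤) (≤-trans k<L (m≤m+n L 0)))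
    build : ∀ y → (∀ w → T (remaining (suc k) w) → Adj G v w → w ≢ z (2 + k) →
      port v w ≢ p × port v w ≢ q × state base w v ≡ y × (∀ t → k < t → t ≤ 16 → w ≢ z t)) → Reach k
    build y nbr with branch-step P Q y
    ... | P′ , Q′ , choose = record
      { P = P′ ; Q = Q′ ; s = s ; base = base ; end = end ; end≤16 = end≤16
      ; k<end = ≤-trans (m≤n+m (suc k) 3) k<end
      ; option = λ m → go (member P′ Q′ m) (choose m) }
      where
      go : ∀ t → (∃ λ j → ∃₂ λ s₁ s₂ → ∃ λ b → Step (member P Q j) s₁ × Step s₁ s₂ ×
              b ≢ proj₂ t × Fits s₂ (proj₁ t , b) × Fits y (proj₁ t , third (proj₂ t) b)) →
        ∃ λ σ′ → Valid (remaining k) σ′ × state σ′ v (z k) ≡ t ×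
               SafeStart σ′ s × (∀ w → (∀ t → k < t → t ≤ end → w ≢ z t) → σ′ w ≡ base w)
      go (R , r) (j , s₁ , s₂ , b , p₁ , p₂ , b≢r , f , g) with option j
      ... | σ , valid , at , safe , same
        with add-thin (2 + k) σ s₁ 3≤L thin₂ valid (subst (λ x → Step x s₁) (sym at) p₁)
               (λ h → ⊥-elim (remaining-∌ {3 + k} {suc k} (n≤1+n (2 + k)) h))
      ... | τ₁ , valid₁ , at₁
        with add-thin (1 + k) (update σ (z (3 + k)) τ₁) s₂ 3≤L thin₁ valid₁ (subst (λ x → Step x s₂) (sym at₁) p₂)
               (λ h → ⊥-elim (remaining-∌ {2 + k} {k} (n≤1+n (1 + k)) h))
      ... | τ₂ , valid₂ , at₂ =
        update σ₂ v τ , extend v τ valid₂ (remaining-∌ {suc k} ≤-refl) (remaining-grow k) new ,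
        trans (state-update-same σ₂ v τ (z k)) (cong (R ,_) (arrange-first p r q b)) ,
        subst (λ x → proj₂ x ≢ 0F ⊎ x ≡ s) (sym unchanged) safe ,
        λ w avoid → trans
          (trans (update-other σ₂ v τ (avoid (suc k) ≤-refl (≤-trans (m≤n+m (suc k) 3) k<end)))
                 (unchanged₂ (avoid (2 + k) (n≤1+n (suc k)) (≤-trans (m≤n+m (2 + k) 2) k<end))
                             (avoid (3 + k) (s≤s (m≤n+m k 2)) (≤-trans (n≤1+n (3 + k)) k<end))))
          (same w λ t k<t → avoid t (≤-trans (m≤n+m (suc k) 3) k<t))
        where
        σ₁ = update σ (z (3 + k)) τ₁
        σ₂ = update σ₁ (z (2 + k)) τ₂
        r≢b : r ≢ b
        r≢b h = b≢r (sym h)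
        τ = mkStar R p r q b (λ h → q≢p (sym h)) r≢b
        unchanged : state (update σ₂ v τ) (z 0) (z 1) ≡ state σ (z 0) (z 1)
        unchanged = trans (state-update-other σ₂ v τ (z 1) (z0≢ (suc k) (s≤s z≤n) (m≤n+m (suc k) 2)))
          (trans (state-update-other σ₁ (z (2 + k)) τ₂ (z 1) (z0≢ (2 + k) (s≤s z≤n) (n≤1+n (2 + k))))
                 (state-update-other σ (z (3 + k)) τ₁ (z 1) (z0≢ (3 + k) (s≤s z≤n) ≤-refl)))
        new : ∀ w → T (remaining (suc k) w) → Adj G v w → Fits (outward τ (port v w)) (state σ₂ w v)
        new-at : ∀ w → T (remaining (suc k) w) → Adj G v w → Dec (w ≡ z (2 + k)) →
          Fits (outward τ (port v w)) (state σ₂ w v)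
        unchanged₂ : ∀ {w} → w ≢ z (2 + k) → w ≢ z (3 + k) → σ₂ w ≡ σ w
        unchanged₂ h₂ h₃ = trans (update-other σ₁ (z (2 + k)) τ₂ h₂) (update-other σ (z (3 + k)) τ₁ h₃)
        new w w∈ vw = new-at w w∈ vw (w ≟ z (2 + k))
        new-at w w∈ vw (yes refl) = subst₂ (λ x u → Fits (R , x) u)
                (sym (arrange-second r b (λ h → q≢p (sym h)))) (sym at₂) (fits-sym _ _ f)
        new-at w w∈ vw (no w≢) with nbr w w∈ vw w≢
        ... | w≢p , w≢q , is-y , avoid = subst₂ (λ x u → Fits (R , x) u)
                (sym (arrange-third r b w≢p w≢q)) (sym (trans (cong (λ x → outward x (port w v))
                  (trans (unchanged₂ w≢ (avoid (3 + k) (s≤s (m≤n+m k 2)) (≤-trans (n≤1+n (3 + k)) (≤-trans k<end end≤16))))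
                         (same w λ t k<t t≤ → avoid t (≤-trans (m≤n+m (suc k) 3) k<t) (≤-trans t≤ end≤16)))) is-y)) (fits-sym _ _ g)
    conclude : Dec (∃ λ w → T (remaining (suc k) w) × Adj G v w × w ≢ z (2 + k)) → Reach k
    -- The default `y` is never tested, since there is no third neighbour.
    conclude (no none) = build (0F , 0F) λ w w∈ vw w≢ → ⊥-elim (none (w , w∈ , vw , w≢))
    conclude (yes (y , y∈ , vy , y≢)) = build (state base y v) λ w w∈ vw w≢ →
      ≢p w w∈ vw , port-≢ vw (link (suc k)) w≢ ,
      cong (λ x → state base x v) (port-injective vw vy
        (only-third q≢p (port-≢ vw (link (suc k)) w≢) (≢p w w∈ vw) (port-≢ vy (link (suc k)) y≢) (≢p y y∈ vy))) ,
      λ t k<t t≤16 → away w vw w≢ t k<t t≤16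
      where
      ≢p : ∀ w → T (remaining (suc k) w) → Adj G v w → port v w ≢ p
      ≢p w w∈ vw = port-≢ vw (back k) (λ { refl → remaining-∌ {suc k} {k′} (s≤s (n≤1+n k′)) w∈ })
      away : ∀ w → Adj G v w → w ≢ z (2 + k) → ∀ t → k < t → t ≤ 16 → w ≢ z t
      away w vw w≢ t k<t t≤16 refl with m≤n⇒m<n∨m≡n k<t
      ... | inj₂ refl = adj-≢ G vw refl
      ... | inj₁ k<t′ with m≤n⇒m<n∨m≡n k<t′
      ...   | inj₂ refl = w≢ refl
      -- As `suc k` is `2 + k′`, a span of 14 reaches `16 + k′` and so covers every `t` up to 16.
      ...   | inj₁ k<t″ = chordless (suc k) t k<t″ (≤-trans t≤16 (m≤m+n 16 k′)) vw

-- Counting along a cycle and the cycle lemma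

count : (ℕ → Bool) → ℕ → ℕ
count f zero    = 0
count f (suc j) = count f j + [ f (suc j) ]

count-mono : ∀ f {i j} → i ≤ j → count f i ≤ count f j
count-mono f {i} {zero}  z≤n = z≤n
count-mono f {i} {suc j} i≤j with m≤n⇒m<n∨m≡n i≤j
... | inj₁ (s≤s i≤j′) = ≤-trans (count-mono f i≤j′) (m≤m+n _ _)
... | inj₂ refl = ≤-refl

count-shift : ∀ f c j → count f c + count (f ∘ (c +_)) j ≡ count f (c + j)
count-shift f c zero = trans (+-identityʳ _) (cong (count f) (sym (+-identityʳ c)))
count-shift f c (suc j) = begin
  count f c + (count (f ∘ (c +_)) j + [ f (c + suc j) ])  ≡⟨ sym (+-assoc (count f c) _ _) ⟩
  count f c + count (f ∘ (c +_)) j + [ f (c + suc j) ]    ≡⟨ cong₂ _+_ (count-shift f c j) (cong (λ x → [ f x ]) (+-suc c j)) ⟩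
  count f (suc (c + j))                                   ≡⟨ cong (count f) (sym (+-suc c j)) ⟩
  count f (c + suc j)                                     ∎
  where open ≡-Reasoning

count-cong : ∀ {f g} → (∀ t → f t ≡ g t) → ∀ j → count f j ≡ count g j
count-cong h zero    = refl
count-cong h (suc j) = cong₂ _+_ (count-cong h j) (cong [_] (h (suc j)))

∑-snoc : ∀ (g : ℕ → ℕ) j → ∑ {suc j} (g ∘ toℕ) ≡ ∑ {j} (g ∘ toℕ) + g j
∑-snoc g zero    = +-identityʳ (g 0)
∑-snoc g (suc j) = trans (cong (g 0 +_) (∑-snoc (g ∘ suc) j)) (sym (+-assoc (g 0) _ _))

count-∑ : ∀ f j → count f j ≡ ∑ {j} (λ k → [ f (suc (toℕ k)) ])
count-∑ f zero    = refl
count-∑ f (suc j) = trans (cong (_+ [ f (suc j) ]) (count-∑ f j)) (sym (∑-snoc (λ k → [ f (suc k) ]) j))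

-- `count` ranges over 1, ..., L and the sum over 0, ..., L - 1; the two extreme terms agree.
count-period : ∀ f L → f L ≡ f 0 → count f L ≡ ∑ {L} (λ k → [ f (toℕ k) ])
count-period f L e = +-cancelˡ-≡ [ f 0 ] _ _ (begin
  [ f 0 ] + count f L                      ≡⟨ cong ([ f 0 ] +_) (count-∑ f L) ⟩
  ∑ {suc L} (λ k → [ f (toℕ k) ])          ≡⟨ ∑-snoc (λ k → [ f k ]) L ⟩
  ∑ {L} (λ k → [ f (toℕ k) ]) + [ f L ]    ≡⟨ +-comm _ [ f L ] ⟩
  [ f L ] + ∑ {L} (λ k → [ f (toℕ k) ])    ≡⟨ cong (λ b → [ b ] + ∑ {L} (λ k → [ f (toℕ k) ])) e ⟩
  [ f 0 ] + ∑ {L} (λ k → [ f (toℕ k) ])    ∎)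
  where open ≡-Reasoning

last-minimum : ∀ (ψ : ℕ → ℕ) N → ∃ λ c → c ≤ N × (∀ j → j ≤ N → ψ c ≤ ψ j) × (∀ j → c < j → j ≤ N → ψ c < ψ j)
last-minimum ψ zero = 0 , z≤n , (λ { _ z≤n → ≤-refl }) , λ { _ 0<j z≤n → ⊥-elim (n≮0 0<j) }
last-minimum ψ (suc N) with last-minimum ψ N
... | c , c≤N , least , last with ψ (suc N) ≤? ψ c
...   | yes h = suc N , ≤-refl , least′ , λ j N<j j≤N → ⊥-elim (<⇒≱ N<j j≤N)
  where
  least′ : ∀ j → j ≤ suc N → ψ (suc N) ≤ ψ j
  least′ j j≤ with m≤n⇒m<n∨m≡n j≤
  ... | inj₁ (s≤s j≤N) = ≤-trans h (least j j≤N)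
  ... | inj₂ refl = ≤-refl
...   | no h = c , m≤n⇒m≤1+n c≤N , least′ , last′
  where
  least′ : ∀ j → j ≤ suc N → ψ c ≤ ψ j
  least′ j j≤ with m≤n⇒m<n∨m≡n j≤
  ... | inj₁ (s≤s j≤N) = least j j≤N
  ... | inj₂ refl = <⇒≤ (≰⇒> h)
  last′ : ∀ j → c < j → j ≤ suc N → ψ c < ψ j
  last′ j c<j j≤ with m≤n⇒m<n∨m≡n j≤
  ... | inj₁ (s≤s j≤N) = last j c<j j≤N
  ... | inj₂ refl = ≰⇒> h

-- Start right after the last minimum of  t − 3 · count f t.
cycle-lemma : ∀ f L → (∀ t → f (L + t) ≡ f t) → count f L * 3 < L →
  ∃ λ c → ∀ j → 1 ≤ j → j ≤ L → count (f ∘ (c +_)) j * 3 < j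
-- Adding three times `count f L` to the potential keeps it a natural number.
cycle-lemma f L periodic sparse with last-minimum (λ j → j + (count f L ∸ count f j) * 3) L
... | c , c≤L , least , last = c , ahead
  where
  K = count f L
  F = count f
  ahead : ∀ j → 1 ≤ j → j ≤ L → count (f ∘ (c +_)) j * 3 < j
  ahead j 1≤j j≤L with (c + j) ≤? L
  -- Within the period, the strict increase after the last minimum suffices.
  ... | yes h = +-cancelˡ-< (c + (K ∸ F (c + j)) * 3) _ _ (subst₂ _<_ eq₁ eq₂ (last (c + j) (m<m+n c 1≤j) h))
    where
    C = count (f ∘ (c +_)) j
    eq₀ : K ∸ F c ≡ (K ∸ F (c + j)) + C
    eq₀ = begin
      K ∸ F c                           ≡⟨ cong (_∸ F c) (sym (m∸n+n≡m (count-mono f h))) ⟩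
      (K ∸ F (c + j)) + F (c + j) ∸ F c ≡⟨ cong (λ x → (K ∸ F (c + j)) + x ∸ F c) (trans (sym (count-shift f c j)) (+-comm (F c) C)) ⟩
      (K ∸ F (c + j)) + (C + F c) ∸ F c ≡⟨ cong (_∸ F c) (sym (+-assoc (K ∸ F (c + j)) C (F c))) ⟩
      (K ∸ F (c + j)) + C + F c ∸ F c   ≡⟨ m+n∸n≡m _ (F c) ⟩
      (K ∸ F (c + j)) + C               ∎
      where open ≡-Reasoning
    eq₁ : c + (K ∸ F c) * 3 ≡ c + (K ∸ F (c + j)) * 3 + C * 3
    eq₁ = trans (cong (λ x → c + x * 3) eq₀) (trans (cong (c +_) (*-distribʳ-+ 3 (K ∸ F (c + j)) C)) (sym (+-assoc c _ _)))
    eq₂ : c + j + (K ∸ F (c + j)) * 3 ≡ c + (K ∸ F (c + j)) * 3 + j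
    eq₂ = trans (+-assoc c j _) (trans (cong (c +_) (+-comm j _)) (sym (+-assoc c _ j)))
  -- Past the period, `r` is the position reduced by `L`. Minimality gives only a weak inequality at
  -- `r`; strictness comes from `sparse`.
  ... | no h = +-cancelˡ-< c _ _ (begin-strict
      c + C * 3                               ≡⟨ cong (λ x → c + x * 3) eqC ⟩
      c + (K ∸ F c + F r) * 3                 ≡⟨ cong (c +_) (*-distribʳ-+ 3 (K ∸ F c) (F r)) ⟩
      c + ((K ∸ F c) * 3 + F r * 3)           ≡⟨ sym (+-assoc c _ _) ⟩
      c + (K ∸ F c) * 3 + F r * 3             ≤⟨ +-monoˡ-≤ (F r * 3) (least r r≤L) ⟩
      r + (K ∸ F r) * 3 + F r * 3             ≡⟨ +-assoc r _ _ ⟩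
      r + ((K ∸ F r) * 3 + F r * 3)           ≡⟨ cong (r +_) (sym (*-distribʳ-+ 3 (K ∸ F r) (F r))) ⟩
      r + (K ∸ F r + F r) * 3                 ≡⟨ cong (λ x → r + x * 3) (m∸n+n≡m (count-mono f r≤L)) ⟩
      r + K * 3                               <⟨ +-monoʳ-< r sparse ⟩
      r + L                                   ≡⟨ m∸n+n≡m (<⇒≤ (≰⇒> h)) ⟩
      c + j                                   ∎)
    where
    open ≤-Reasoning
    C = count (f ∘ (c +_)) j
    r = c + j ∸ L
    c+j≡ : c + j ≡ L + r
    c+j≡ = sym (m+[n∸m]≡n (<⇒≤ (≰⇒> h)))
    r≤L : r ≤ L
    r≤L = ≤-trans (≤-trans (∸-monoʳ-≤ (c + j) j≤L) (≤-reflexive (m+n∸n≡m c j))) c≤L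
    eqC : C ≡ K ∸ F c + F r
    eqC = +-cancelˡ-≡ (F c) _ _ (begin-equality
      F c + C               ≡⟨ count-shift f c j ⟩
      F (c + j)             ≡⟨ cong F c+j≡ ⟩
      F (L + r)             ≡⟨ sym (count-shift f L r) ⟩
      K + count (f ∘ (L +_)) r ≡⟨ cong (K +_) (count-cong periodic r) ⟩
      K + F r               ≡⟨ cong (_+ F r) (sym (m+[n∸m]≡n (count-mono f c≤L))) ⟩
      F c + (K ∸ F c) + F r ≡⟨ +-assoc (F c) _ _ ⟩
      F c + (K ∸ F c + F r) ∎)

-- Cycles as periodic sequences

module _ {n : ℕ} {G : Graph n} where

  ring : ∀ {m} {X : Fin n → Bool} (Z : Cycle G m) → (∀ i → T (X (Cycle.vertex Z i))) → Ring G X (suc m)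
  ring {m} {X} Z inX = record
    { z = z ; period = period ; distinct = distinct ; link = link ; inside = λ t → inX (index t) }
    where
    open Cycle Z
    index : ℕ → Fin (suc m)
    index t = fromℕ< (m%n<n t (suc m))
    toℕ-index : ∀ t → toℕ (index t) ≡ t % suc m
    toℕ-index t = toℕ-fromℕ< (m%n<n t (suc m))
    index-≡ : ∀ {s t} → s % suc m ≡ t % suc m → index s ≡ index t
    index-≡ {s} {t} e = toℕ-injective (trans (toℕ-index s) (trans e (sym (toℕ-index t))))
    z : ℕ → Fin n
    z t = vertex (index t)
    period : ∀ t → z (suc m + t) ≡ z t
    period t = cong vertex (index-≡ {suc m + t} {t} (trans (cong (_% suc m) (+-comm (suc m) t)) ([m+n]%n≡m%n t (suc m))))
    distinct : ∀ {a b} → a < b → b < suc m + a → z a ≢ z b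
    distinct {a} {b} a<b b<L+a e = contradiction-by (<-cmp (a / suc m) (b / suc m))
      where
      L = suc m
      rem : a % L ≡ b % L
      rem = trans (sym (toℕ-index a)) (trans (cong toℕ (injective e)) (toℕ-index b))
      a≡ : a ≡ b % L + a / L * L
      a≡ = trans (m≡m%n+[m/n]*n a L) (cong (_+ a / L * L) rem)
      b≡ : b ≡ b % L + b / L * L
      b≡ = m≡m%n+[m/n]*n b L
      contradiction-by : Tri (a / L < b / L) (a / L ≡ b / L) (b / L < a / L) → ⊥
      contradiction-by (tri≈ _ h _) = <-irrefl (trans a≡ (trans (cong (λ q → b % L + q * L) h) (sym b≡))) a<b
      contradiction-by (tri> _ _ h) = <⇒≱ a<b (subst₂ _≤_ (sym b≡) (sym a≡) (+-monoʳ-≤ (b % L) (*-monoˡ-≤ L (<⇒≤ h))))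
      contradiction-by (tri< h _ _) = <⇒≱ b<L+a (begin
        L + a                       ≡⟨ cong (L +_) a≡ ⟩
        L + (b % L + a / L * L)     ≡⟨ sym (+-assoc L _ _) ⟩
        L + b % L + a / L * L       ≡⟨ cong (_+ a / L * L) (+-comm L (b % L)) ⟩
        b % L + L + a / L * L       ≡⟨ +-assoc (b % L) L _ ⟩
        b % L + suc (a / L) * L     ≤⟨ +-monoʳ-≤ (b % L) (*-monoˡ-≤ L h) ⟩
        b % L + b / L * L           ≡⟨ sym b≡ ⟩
        b                           ∎)
        where open ≤-Reasoning
    link : ∀ t → Adj G (z t) (z (suc t))
    link t = by-cases (m≤n⇒m<n∨m≡n (m%n<n t (suc m)))
      where
      L = suc m
      r = t % L
      suc% : suc t % L ≡ suc r % L
      suc% = trans (cong (λ x → suc x % L) (m≡m%n+[m/n]*n t L)) ([m+kn]%n≡m%n (suc r) (t / L) L)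
      by-cases : suc r < L ⊎ suc r ≡ L → Adj G (z t) (z (suc t))
      by-cases (inj₁ (s≤s r<m)) = subst₂ (Adj G) (cong vertex e₁) (cong vertex e₂) (step (fromℕ< r<m))
        where
        e₁ : inject₁ (fromℕ< r<m) ≡ index t
        e₁ = toℕ-injective (trans (toℕ-inject₁ _) (trans (toℕ-fromℕ< r<m) (sym (toℕ-index t))))
        e₂ : suc (fromℕ< r<m) ≡ index (suc t)
        e₂ = toℕ-injective (trans (cong suc (toℕ-fromℕ< r<m))
               (sym (trans (toℕ-index (suc t)) (trans suc% (m<n⇒m%n≡m (s≤s r<m))))))
      by-cases (inj₂ e) = subst₂ (Adj G) (cong vertex e₁) (cong vertex e₂) close
        where
        e₁ : fromℕ m ≡ index t
        e₁ = toℕ-injective (trans (toℕ-fromℕ m) (sym (trans (toℕ-index t) (cong pred e))))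
        e₂ : zero ≡ index (suc t)
        e₂ = toℕ-injective (sym (trans (toℕ-index (suc t)) (trans suc% (trans (cong (_% L) e) (n%n≡0 L)))))

  ring-vertex : ∀ {m} {X : Fin n → Bool} (Z : Cycle G m) (inX : ∀ i → T (X (Cycle.vertex Z i))) i →
    Ring.z (ring {X = X} Z inX) (toℕ i) ≡ Cycle.vertex Z i
  ring-vertex {m} Z inX i = cong (Cycle.vertex Z) (toℕ-injective
    (trans (toℕ-fromℕ< (m%n<n (toℕ i) (suc m))) (m<n⇒m%n≡m (toℕ<n i))))

  rotate : ∀ {X : Fin n → Bool} {L} → ℕ → Ring G X L → Ring G X L
  rotate {X} {L} c R = record
    { z = z ∘ (c +_)
    ; period = λ t → trans (cong z (trans (sym (+-assoc c L t)) (trans (cong (_+ t) (+-comm c L)) (+-assoc L c t)))) (period (c + t))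
    ; distinct = λ {a} {b} a<b b<L+a → distinct (+-monoʳ-< c a<b)
        (subst (c + b <_) (trans (sym (+-assoc c L a)) (trans (cong (_+ a) (+-comm c L)) (+-assoc L c a))) (+-monoʳ-< c b<L+a))
    ; link = λ t → subst (λ x → Adj G (z (c + t)) (z x)) (sym (+-suc c t)) (link (c + t))
    ; inside = λ t → inside (c + t) }
    where open Ring R

  -- The chord would close the stretch from `z a` to `z b` into a cycle with at most 15 vertices.
  chordless : ∀ {X : Fin n → Bool} {L} → 16 ≤ L → GirthAtLeast 16 G → (R : Ring G X L) →
    ∀ a b → 2 + a ≤ b → b ≤ 14 + a → ¬ Adj G (Ring.z R a) (Ring.z R b)
  chordless {L = L} 16≤L girth R a b a<b b≤a ab = <⇒≱ (s≤s (s≤s d≤14)) (girth cycle)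
    where
    open Ring R
    d = b ∸ a
    a≤b : a ≤ b
    a≤b = ≤-trans (m≤n+m a 2) a<b
    d≤14 : d ≤ 14
    d≤14 = ≤-trans (∸-monoˡ-≤ a b≤a) (≤-reflexive (m+n∸n≡m 14 a))
    a+d≡b : a + d ≡ b
    a+d≡b = m+[n∸m]≡n a≤b
    2≤d : 2 ≤ d
    2≤d = ≤-trans (≤-reflexive (sym (m+n∸n≡m 2 a))) (∸-monoˡ-≤ a a<b)
    apart : ∀ {i j : ℕ} → i < j → j ≤ d → z (a + i) ≢ z (a + j)
    apart {i} {j} i<j j≤d = distinct (+-monoʳ-< a i<j) (≤-trans (s≤s (+-monoʳ-≤ a (≤-trans j≤d d≤14)))
      (≤-trans (≤-reflexive (trans (cong suc (+-comm a 14)) refl)) (+-mono-≤ (≤-trans (n≤1+n 15) 16≤L) (m≤m+n a i))))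
    cycle : Cycle G d
    cycle = record
      { 3≤length = s≤s 2≤d
      ; vertex = λ i → z (a + toℕ i)
      ; injective = inj
      ; step = λ i → subst₂ (λ x y → Adj G (z x) (z y)) (cong (a +_) (sym (toℕ-inject₁ i))) (sym (+-suc a (toℕ i))) (link (a + toℕ i))
      ; close = subst₂ (λ x y → Adj G (z x) (z y)) (trans (sym a+d≡b) (cong (a +_) (sym (toℕ-fromℕ d)))) (sym (+-identityʳ a)) (adj-symᵀ G ab) }
      where
      inj : ∀ {i j : Fin (suc d)} → z (a + toℕ i) ≡ z (a + toℕ j) → i ≡ j
      inj {i} {j} e with <-cmp (toℕ i) (toℕ j)
      ... | tri< h _ _ = ⊥-elim (apart h (toℕ≤pred[n] j) e)
      ... | tri≈ _ h _ = toℕ-injective h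
      ... | tri> _ _ h = ⊥-elim (apart h (toℕ≤pred[n] i) (sym e))

-- The chain of blocks along a sparse cycle

module _ {n : ℕ} (G : Graph n) (subcubic : Subcubic G) (X B : Fin n → Bool)
  (thin : ∀ {v a b} → ¬ T (B v) → T (X a) → Adj G v a → T (X b) → Adj G v b → a ≢ b → Thin G X v a b)
  (girth : GirthAtLeast 16 G) where

  open Colouring G subcubic

  thin-at : ∀ {L} → 16 ≤ L → (R : Ring G X L) → ∀ k → ¬ T (B (Ring.z R (suc k))) → Chain.ThinAt G subcubic X L R k
  thin-at 16≤L R k h = thin h (inside k) (adj-symᵀ G (link k)) (inside (2 + k)) (link (suc k))
    (distinct (s≤s (n≤1+n k)) (+-monoˡ-≤ k (≤-trans (m≤m+n 3 13) 16≤L)))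
    where open Ring R

  -- After `j` blocks the vertices up to `z (3 + j * 3)` contain `j` members of `B`. Since `z L` is
  -- one of at most five, `j` never exceeds 4, and the chain ends at `z 16` at the latest.
  scan : ∀ {L} → 16 ≤ L → (R : Ring G X L) → SmallerColourable X →
    let β = λ t → B (Ring.z R t) in
    T (β L) → count β L ≤ 5 → (∀ j → 1 ≤ j → j ≤ L → count β j * 3 < j) →
    ∀ fuel j → fuel + j ≡ 4 → count β (3 + j * 3) ≡ j → 4 + j * 3 ≤ L →
    Chain.Reach G subcubic X L R (3 + j * 3)
  scan {L} 16≤L R smaller BL few ahead fuel j fuel+j≡4 seen k<L with B (Ring.z R (4 + j * 3)) in eq
  -- Another thin vertex follows; having lost `z k`, it keeps no neighbour but `z (2 + k)`.
  ... | false = reach-end k (s≤s (s≤s z≤n)) (+-monoʳ-≤ 4 (*-monoˡ-≤ 3 j≤4)) k<L smaller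
      λ w w′ w∈ vw w′∈ vw′ → trans (next w w∈ vw) (sym (next w′ w′∈ vw′))
    where
    k = 3 + j * 3
    open Ring R
    open Chain G subcubic X L R
    j≤4 : j ≤ 4
    j≤4 = subst (j ≤_) fuel+j≡4 (m≤n+m j fuel)
    next : ∀ w → T (remaining (suc k) w) → Adj G (z (suc k)) w → w ≡ z (2 + k)
    next w w∈ vw with thin-at 16≤L R k (λ h → subst T eq h) w (remaining-⊆ (suc k) w w∈) vw
    ... | inj₁ refl = ⊥-elim (remaining-∌ {suc k} {2 + j * 3} (s≤s (n≤1+n (2 + j * 3))) w∈)
    ... | inj₂ e = e
  ... | true with m≤n⇒m<n∨m≡n k<L
  -- The cycle closes: two ports of the end vertex face the removed vertices `z k` and `z 1`, which
  -- leaves one.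
  ...   | inj₂ refl = reach-end k (s≤s (s≤s z≤n)) (+-monoʳ-≤ 4 (*-monoˡ-≤ 3 j≤4)) k<L smaller
      λ w w′ w∈ vw w′∈ vw′ → port-injective vw vw′
        (only-third p≢q (≢p w w∈ vw) (≢q w w∈ vw) (≢p w′ w′∈ vw′) (≢q w′ w′∈ vw′))
    where
    k = 3 + j * 3
    open Ring R
    open Chain G subcubic X L R
    j≤4 : j ≤ 4
    j≤4 = subst (j ≤_) fuel+j≡4 (m≤n+m j fuel)
    v = z (suc k)
    wrap : z (2 + k) ≡ z 1
    wrap = trans (cong z (sym (+-comm (suc k) 1))) (period 1)
    p≢q : port v (z k) ≢ port v (z (2 + k))
    p≢q = port-≢ (back k) (link (suc k)) (distinct (s≤s (n≤1+n k)) (+-monoˡ-≤ k (≤-trans (m≤m+n 3 13) 16≤L)))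
    ≢p : ∀ w → T (remaining (suc k) w) → Adj G v w → port v w ≢ port v (z k)
    ≢p w w∈ vw = port-≢ vw (back k) λ { refl → remaining-∌ {suc k} {2 + j * 3} (s≤s (n≤1+n (2 + j * 3))) w∈ }
    ≢q : ∀ w → T (remaining (suc k) w) → Adj G v w → port v w ≢ port v (z (2 + k))
    ≢q w w∈ vw = port-≢ vw (link (suc k)) λ e → remaining-∌ {suc k} {0} (s≤s z≤n)
      (subst (λ x → T (remaining (suc k) x)) (trans e wrap) w∈)
  ...   | inj₁ k<L′ = continue fuel fuel+j≡4
    where
    k = 3 + j * 3
    open Ring R
    open Chain G subcubic X L R
    β : ℕ → Bool
    β t = B (z t)
    c₁ : count β (suc k) ≡ suc j
    c₁ = trans (cong₂ _+_ seen (cong [_] eq)) (+-comm j 1)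
    thin₂ : ¬ T (β (2 + k))
    thin₂ h = <⇒≱ (ahead (2 + k) (s≤s z≤n) k<L′) (≤-trans (n≤1+n (5 + j * 3))
      (≤-reflexive (sym (cong (_* 3) (trans (cong₂ _+_ c₁ (T⇒[]≡1 h)) (+-comm (suc j) 1))))))
    c₂ : count β (2 + k) ≡ suc j
    c₂ = trans (cong₂ _+_ c₁ (¬T⇒[]≡0 thin₂)) (+-identityʳ (suc j))
    2+k<L : 2 + k < L
    2+k<L = ≤∧≢⇒< k<L′ λ e → thin₂ (subst (λ x → T (β x)) (sym e) BL)
    -- This is tight: `2 + j` members of `B` among `6 + j * 3` positions give equality, which
    -- `ahead` just excludes.
    thin₃ : ¬ T (β (3 + k))
    thin₃ h = <⇒≱ (ahead (3 + k) (s≤s z≤n) 2+k<L)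
      (≤-reflexive (sym (cong (_* 3) (trans (cong₂ _+_ c₂ (T⇒[]≡1 h)) (+-comm (suc j) 1)))))
    c₃ : count β (3 + k) ≡ suc j
    c₃ = trans (cong₂ _+_ c₂ (¬T⇒[]≡0 thin₃)) (+-identityʳ (suc j))
    3+k<L : 3 + k < L
    3+k<L = ≤∧≢⇒< 2+k<L λ e → thin₃ (subst (λ x → T (β x)) (sym e) BL)
    c-last : ∀ {l} → 3 + k < l → T (β l) → 2 + j ≤ count β l
    c-last {suc l} (s≤s h) b = ≤-trans (≤-reflexive (trans (+-comm 1 (suc j)) (sym (cong₂ _+_ c₃ (T⇒[]≡1 b)))))
      (+-monoˡ-≤ [ β (suc l) ] (count-mono β h))
    continue : ∀ fuel → fuel + j ≡ 4 → Reach k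
    -- With four blocks behind, `z (suc k)` is a fifth member of `B` and `z L` would be a sixth.
    continue zero e = ⊥-elim (<⇒≱ (≤-reflexive (cong (λ x → 2 + x) (sym e))) (≤-trans (c-last 3+k<L BL) few))
    continue (suc fuel′) e = reach-branch k (s≤s z≤n) 3+k<L (chordless 16≤L girth R)
      (thin-at 16≤L R (1 + k) thin₂) (thin-at 16≤L R (2 + k) thin₃)
      (scan 16≤L R smaller BL few ahead fuel′ (suc j) (trans (+-suc fuel′ j) e) c₃ 3+k<L)

  close : ∀ {L} → (16≤L : 16 ≤ L) (R : Ring G X L) →
    ¬ T (B (Ring.z R 1)) → ¬ T (B (Ring.z R 2)) → ¬ T (B (Ring.z R 3)) →
    Chain.Reach G subcubic X L R 3 → Colourable X
  close 16≤L R h₁ h₂ h₃ = Chain.close-ring G subcubic X _ R (≤-trans (m≤m+n 5 11) 16≤L)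
    (thin-at 16≤L R 0 h₁) (thin-at 16≤L R 1 h₂) (thin-at 16≤L R 2 h₃)

  -- With four consecutive thin vertices the chain needs no block: `z 4` is its far end.
  thread-colourable : ∀ {L} → 16 ≤ L → (R : Ring G X L) → SmallerColourable X →
    ¬ T (B (Ring.z R 1)) → ¬ T (B (Ring.z R 2)) → ¬ T (B (Ring.z R 3)) → ¬ T (B (Ring.z R 4)) → Colourable X
  thread-colourable {L} 16≤L R smaller h₁ h₂ h₃ h₄ = close 16≤L R h₁ h₂ h₃
    (reach-end 3 (s≤s (s≤s z≤n)) (m≤m+n 4 12) (≤-trans (m≤m+n 4 12) 16≤L) smaller
      λ w w′ w∈ vw w′∈ vw′ → trans (next w w∈ vw) (sym (next w′ w′∈ vw′)))
    where
    open Ring R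
    open Chain G subcubic X L R
    next : ∀ w → T (remaining 4 w) → Adj G (z 4) w → w ≡ z 5
    next w w∈ vw with thin-at 16≤L R 3 h₄ w (remaining-⊆ 4 w w∈) vw
    ... | inj₁ refl = ⊥-elim (remaining-∌ {4} {2} (n≤1+n 3) w∈)
    ... | inj₂ e = e

  ring-colourable : ∀ {L} → 16 ≤ L → (R : Ring G X L) → SmallerColourable X →
    count (λ t → B (Ring.z R t)) L ≤ 5 → Colourable X
  ring-colourable {L@(suc m)} 16≤L R smaller few
    with cycle-lemma β L (λ t → cong B (period t)) (≤-trans (s≤s (*-monoˡ-≤ 3 few)) 16≤L)
    where
    open Ring R
    β : ℕ → Bool
    β t = B (z t)
  ... | c , ahead = by-cases (B (z c)) refl
    where
    open Ring R
    β : ℕ → Bool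
    β t = B (z t)
    R′ = rotate c R
    β′ : ℕ → Bool
    β′ t = B (Ring.z R′ t)
    few′ : count β′ L ≤ 5
    few′ = ≤-trans (≤-reflexive (+-cancelˡ-≡ (count β c) _ _ (begin
      count β c + count β′ L              ≡⟨ count-shift β c L ⟩
      count β (c + L)                     ≡⟨ cong (count β) (+-comm c L) ⟩
      count β (L + c)                     ≡⟨ sym (count-shift β L c) ⟩
      count β L + count (β ∘ (L +_)) c    ≡⟨ cong (count β L +_) (count-cong (λ t → cong B (period t)) c) ⟩
      count β L + count β c               ≡⟨ +-comm (count β L) _ ⟩
      count β c + count β L               ∎))) few
      where open ≡-Reasoning
    thin₁ : ¬ T (β′ 1)
    thin₁ h = <⇒≱ (ahead 1 ≤-refl (s≤s z≤n)) (≤-trans (s≤s z≤n)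
      (≤-reflexive (sym (cong (_* 3) (T⇒[]≡1 h)))))
    c₁ : count β′ 1 ≡ 0
    c₁ = ¬T⇒[]≡0 thin₁
    thin₂ : ¬ T (β′ 2)
    thin₂ h = <⇒≱ (ahead 2 (s≤s z≤n) (≤-trans (m≤m+n 2 14) 16≤L)) (≤-trans (n≤1+n 2)
      (≤-reflexive (sym (cong (_* 3) (cong₂ _+_ c₁ (T⇒[]≡1 h))))))
    c₂ : count β′ 2 ≡ 0
    c₂ = cong₂ _+_ c₁ (¬T⇒[]≡0 thin₂)
    thin₃ : ¬ T (β′ 3)
    thin₃ h = <⇒≱ (ahead 3 (s≤s z≤n) (≤-trans (m≤m+n 3 13) 16≤L))
      (≤-reflexive (sym (cong (_* 3) (cong₂ _+_ c₂ (T⇒[]≡1 h)))))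
    c₃ : count β′ 3 ≡ 0
    c₃ = cong₂ _+_ c₂ (¬T⇒[]≡0 thin₃)
    wrap : ∀ t → z (c + m + suc t) ≡ z (c + t)
    wrap t = trans (cong z (begin
      c + m + suc t      ≡⟨ +-suc (c + m) t ⟩
      suc (c + m + t)    ≡⟨ cong suc (trans (cong (_+ t) (+-comm c m)) (+-assoc m c t)) ⟩
      suc m + (c + t)    ∎)) (period (c + t))
      where open ≡-Reasoning
    -- The three vertices after `z c` are thin. If `z c` is thin too, four thin vertices start
    -- there; rotating by `c + m`, which is `c − 1` modulo `L`, puts them at positions 1 to 4.
    by-cases : ∀ b → B (z c) ≡ b → Colourable X
    by-cases true eq = close 16≤L R′ thin₁ thin₂ thin₃
      (scan 16≤L R′ smaller (subst T (cong B (sym (trans (cong z (+-comm c L)) (period c)))) (subst T (sym eq) tt))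
        few′ ahead 4 0 refl c₃ (≤-trans (m≤m+n 4 12) 16≤L))
    by-cases false eq = thread-colourable 16≤L (rotate (c + m) R) smaller
      (λ h → subst T eq (subst T (cong B (trans (wrap 0) (cong z (+-identityʳ c)))) h))
      (λ h → thin₁ (subst T (cong B (wrap 1)) h))
      (λ h → thin₂ (subst T (cong B (wrap 2)) h))
      (λ h → thin₃ (subst T (cong B (wrap 3)) h))

  sparse-cycle-colourable : ∀ {m} (Z : Cycle G m) → (∀ i → T (X (Cycle.vertex Z i))) →
    ∑ (λ i → [ B (Cycle.vertex Z i) ]) ≤ 5 → SmallerColourable X → Colourable X
  sparse-cycle-colourable {m} Z inX few smaller = ring-colourable (girth Z) R smaller
    (≤-trans (≤-reflexive (trans
      (count-period (λ t → B (Ring.z R t)) (suc m) (cong B (trans (cong (Ring.z R) (sym (+-identityʳ (suc m)))) (Ring.period R 0))))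
      (sum-cong-≗ λ i → cong (λ x → [ B x ]) (ring-vertex {X = X} Z inX i)))) few)
    where
    R = ring Z inX

-- Finding cycles

DistinctBelow : ∀ {n} → (ℕ → Fin n) → ℕ → Set
DistinctBelow x N = ∀ {i j} → i < j → j < N → x i ≢ x j

find-below : ∀ {n} (x : ℕ → Fin n) v N → (∃ λ i → i < N × x i ≡ v) ⊎ (∀ i → i < N → x i ≢ v)
find-below x v zero = inj₂ λ _ ()
find-below x v (suc N) with x N ≟ v
... | yes e = inj₁ (N , ≤-refl , e)
... | no ¬e with find-below x v N
...   | inj₁ (i , i<N , e) = inj₁ (i , m≤n⇒m≤1+n i<N , e)
...   | inj₂ none = inj₂ below
  where
  below : ∀ i → i < suc N → x i ≢ v
  below i (s≤s i≤N) with m≤n⇒m<n∨m≡n i≤N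
  ... | inj₁ i<N  = none i i<N
  ... | inj₂ refl = ¬e

-- The repetition found has the least possible `j`, so all earlier terms are distinct and can form a
-- cycle.
first-repetition : ∀ {n} (x : ℕ → Fin n) N →
  DistinctBelow x N ⊎ (∃₂ λ i j → i < j × x i ≡ x j × DistinctBelow x j)
first-repetition x zero = inj₁ λ _ ()
first-repetition x (suc N) with first-repetition x N
... | inj₂ r = inj₂ r
... | inj₁ distinct with find-below x (x N) N
...   | inj₁ (i , i<N , e) = inj₂ (i , N , i<N , e , distinct)
...   | inj₂ none = inj₁ distinct′
  where
  distinct′ : DistinctBelow x (suc N)
  distinct′ {i} i<j (s≤s j≤N) with m≤n⇒m<n∨m≡n j≤N
  ... | inj₁ j<N  = distinct i<j j<N
  ... | inj₂ refl = none i i<j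

repetition : ∀ {n} (x : ℕ → Fin n) → ∃₂ λ i j → i < j × x i ≡ x j × DistinctBelow x j
repetition {n} x with first-repetition x (suc n)
... | inj₂ r = r
... | inj₁ distinct = ⊥-elim (<-irrefl refl (injective⇒≤ {f = λ (i : Fin (suc n)) → x (toℕ i)} inj))
  where
  inj : ∀ {i j : Fin (suc n)} → x (toℕ i) ≡ x (toℕ j) → i ≡ j
  inj {i} {j} e with <-cmp (toℕ i) (toℕ j)
  ... | tri< h _ _ = ⊥-elim (distinct h (toℕ<n j) e)
  ... | tri≈ _ h _ = toℕ-injective h
  ... | tri> _ _ h = ⊥-elim (distinct h (toℕ<n i) (sym e))

module _ {n : ℕ} {G : Graph n} where

  -- The stretch between a vertex and its first recurrence is a cycle: `link` excludes length 1 and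
  -- `turn` excludes length 2.
  walk-cycle : ∀ (x : ℕ → Fin n) → (∀ t → Adj G (x t) (x (suc t))) → (∀ t → x t ≢ x (2 + t)) →
    ∃₂ λ m (Z : Cycle G m) → ∀ i → ∃ λ t → Cycle.vertex Z i ≡ x t
  walk-cycle x link turn with repetition x
  ... | i , j , i<j , e , distinct = build (j ∸ suc i) (trans (+-suc i _) (m+[n∸m]≡n i<j))
    where
    build : ∀ m → i + suc m ≡ j → ∃₂ λ m (Z : Cycle G m) → ∀ i → ∃ λ t → Cycle.vertex Z i ≡ x t
    build m refl = m , cycle , λ k → i + toℕ k , refl
      where
      long : ∀ m → x i ≡ x (i + suc m) → 3 ≤ suc m
      long 0 e = ⊥-elim (adj-≢ G (link i) (trans e (cong x (+-comm i 1))))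
      long 1 e = ⊥-elim (turn i (trans e (cong x (+-comm i 2))))
      long (suc (suc m)) _ = s≤s (s≤s (s≤s z≤n))
      inj : ∀ {k l : Fin (suc m)} → x (i + toℕ k) ≡ x (i + toℕ l) → k ≡ l
      inj {k} {l} e with <-cmp (toℕ k) (toℕ l)
      ... | tri< h _ _ = ⊥-elim (distinct (+-monoʳ-< i h) (+-monoʳ-< i (toℕ<n l)) e)
      ... | tri≈ _ h _ = toℕ-injective h
      ... | tri> _ _ h = ⊥-elim (distinct (+-monoʳ-< i h) (+-monoʳ-< i (toℕ<n k)) (sym e))
      cycle : Cycle G m
      cycle = record
        { 3≤length = long m e
        ; vertex = λ k → x (i + toℕ k)
        ; injective = inj
        ; step = λ k → subst₂ (λ a b → Adj G (x a) (x b)) (cong (i +_) (sym (toℕ-inject₁ k))) (sym (+-suc i (toℕ k))) (link (i + toℕ k))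
        ; close = subst₂ (Adj G) (cong (λ a → x (i + a)) (sym (toℕ-fromℕ m)))
            (trans (cong x (sym (+-suc i m))) (trans (sym e) (cong x (sym (+-identityʳ i))))) (link (i + m)) }

  dart-cycle : ∀ (∂ : Dart G → Bool) →
    (∀ d → T (∂ d) → ∃ λ e → T (∂ e) × src e ≡ tgt d × tgt e ≢ src d) → ∀ d → T (∂ d) →
    ∃₂ λ m (Z : Cycle G m) → ∀ i → ∃ λ e → T (∂ e) × src e ≡ Cycle.vertex Z i
  dart-cycle ∂ advance d₀ ∂d₀ = conclude (walk-cycle x link turn)
    where
    walk : ℕ → ∃ λ d → T (∂ d)
    walk zero = d₀ , ∂d₀
    walk (suc t) with advance (proj₁ (walk t)) (proj₂ (walk t))
    ... | e , ∂e , _ = e , ∂e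
    x : ℕ → Fin n
    x t = src (proj₁ (walk t))
    tgt-walk : ∀ t → x (suc t) ≡ tgt (proj₁ (walk t))
    tgt-walk t with advance (proj₁ (walk t)) (proj₂ (walk t))
    ... | e , _ , s , _ = s
    link : ∀ t → Adj G (x t) (x (suc t))
    link t = subst (Adj G (x t)) (sym (tgt-walk t)) (Dart.adjacent (proj₁ (walk t)))
    turn′ : ∀ t → tgt (proj₁ (walk (suc t))) ≢ x t
    turn′ t with advance (proj₁ (walk t)) (proj₂ (walk t))
    ... | e , _ , _ , t≢ = t≢
    turn : ∀ t → x t ≢ x (2 + t)
    turn t e = turn′ t (sym (trans e (tgt-walk (suc t))))
    conclude : (∃₂ λ m (Z : Cycle G m) → ∀ i → ∃ λ t → Cycle.vertex Z i ≡ x t) →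
      ∃₂ λ m (Z : Cycle G m) → ∀ i → ∃ λ e → T (∂ e) × src e ≡ Cycle.vertex Z i
    conclude (m , Z , on) = m , Z , λ i →
      proj₁ (walk (proj₁ (on i))) , proj₂ (walk (proj₁ (on i))) , sym (proj₂ (on i))

-- Faces of the planar map

∑-↑ : ∀ m {n} (h : Fin (m + n) → ℕ) → ∑ h ≡ ∑ (λ i → h (i ↑ˡ n)) + ∑ (λ j → h (m ↑ʳ j))
∑-↑ zero    h = refl
∑-↑ (suc m) h = trans (cong (h zero +_) (∑-↑ m (h ∘ suc))) (sym (+-assoc (h zero) _ _))

does-true : ∀ {a} {A : Set a} (A? : Dec A) → T (does A?) → A
does-true (yes a) _ = a

does-false : ∀ {A : Set} (A? : Dec A) → T (not (does A?)) → ¬ A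
does-false (no ¬a) _ = ¬a

T-not : ∀ {b} → ¬ T b → T (not b)
T-not {true}  h = ⊥-elim (h tt)
T-not {false} _ = tt

does-sound : ∀ {A : Set} (A? : Dec A) → A → T (does A?)
does-sound A? a = subst T (sym (dec-true A? a)) tt

module _ {n : ℕ} {G : Graph n} where

  dart-≡ : ∀ {d e : Dart G} → src d ≡ src e → tgt d ≡ tgt e → d ≡ e
  dart-≡ {dart u v p} {dart _ _ q} refl refl = cong (dart u v) (T-irrelevant p q)

  rev-rev : ∀ (d : Dart G) → rev (rev d) ≡ d
  rev-rev d = dart-≡ refl refl

  src≢tgt : ∀ (d : Dart G) → src d ≢ tgt d
  src≢tgt d = adj-≢ G (Dart.adjacent d)

  rev-≢ : ∀ (d : Dart G) → d ≢ rev d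
  rev-≢ d e = src≢tgt d (cong src e)

  rev-orbit : ∀ {d e : Dart G} → SameOrbit (rev {G = G}) d e → e ≡ d ⊎ e ≡ rev d
  rev-orbit ε = inj₁ refl
  rev-orbit {d} (refl ◅ s) with rev-orbit s
  ... | inj₁ h = inj₂ h
  ... | inj₂ h = inj₁ (trans h (rev-rev d))

module Map {n : ℕ} {G : Graph n} (planar : Planar G) where

  open Planar planar

  module Orbits {R : Dart G → Dart G → Set} {k : ℕ} (classes : Classes R k) where
    open Classes classes

    representative : Fin k → Dart G
    representative i = proj₁ (surjective i)

    class-representative : ∀ i → class (representative i) ≡ i
    class-representative i = proj₂ (surjective i) refl

    same : ∀ {d e} → R d e → class d ≡ class e
    same {d} {e} = Equivalence.from (fibres d e)

    related : ∀ {d e} → class d ≡ class e → R d e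
    related {d} {e} = Equivalence.to (fibres d e)

  open Orbits vertices public using () renaming
    (representative to vertexDart; class-representative to vertex-vertexDart; same to vertex-same; related to vertex-related)
  open Orbits edges public using () renaming
    (representative to edgeDart; class-representative to edge-edgeDart; same to edge-same; related to edge-related)
  open Orbits faces public using () renaming
    (representative to faceDart; class-representative to face-faceDart; same to face-same)
  open Orbits components public using () renaming
    (same to component-same; related to component-related)

  vertexOf : Dart G → Fin #V
  vertexOf = Classes.class vertices
  edgeOf : Dart G → Fin #E
  edgeOf = Classes.class edges
  faceOf : Dart G → Fin #F
  faceOf = Classes.class faces
  componentOf : Dart G → Fin #C
  componentOf = Classes.class components

  vertexOf-≡ : ∀ {d e} → src d ≡ src e → vertexOf d ≡ vertexOf e
  vertexOf-≡ {d} {e} h = vertex-same (Equivalence.to (vertexOrbits d e) h)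

  vertexOf-src : ∀ {d e} → vertexOf d ≡ vertexOf e → src d ≡ src e
  vertexOf-src {d} {e} h = Equivalence.from (vertexOrbits d e) (vertex-related h)

  src-next : ∀ d → src (next d) ≡ src d
  src-next d = sym (Equivalence.from (vertexOrbits d (next d)) (refl ◅ ε))

  faceOf-next : ∀ d → faceOf (next d) ≡ faceOf (rev d)
  faceOf-next d = sym (face-same {rev d} {next d} (cong next (rev-rev d) ◅ ε))

  faceOf-face : ∀ d → faceOf (face d) ≡ faceOf d
  faceOf-face d = sym (face-same {d} {face d} (refl ◅ ε))

  edgeOf-rev : ∀ d → edgeOf (rev d) ≡ edgeOf d
  edgeOf-rev d = sym (edge-same {d} {rev d} (refl ◅ ε))

  edge-cases : ∀ d → d ≡ edgeDart (edgeOf d) ⊎ d ≡ rev (edgeDart (edgeOf d))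
  edge-cases d = rev-orbit (edge-related (edge-edgeDart (edgeOf d)))

  -- A numbering of the darts: `rev` fixes none, so every edge has exactly two. It turns `face` into
  -- a permutation of a finite index set, over which sums can be rearranged.
  dartAt : Fin (#E + #E) → Dart G
  dartAt i = [ edgeDart , rev ∘ edgeDart ]′ (splitAt #E i)

  codeFrom : ∀ d → d ≡ edgeDart (edgeOf d) ⊎ d ≡ rev (edgeDart (edgeOf d)) → Fin (#E + #E)
  codeFrom d (inj₁ _) = edgeOf d ↑ˡ #E
  codeFrom d (inj₂ _) = #E ↑ʳ edgeOf d

  code : Dart G → Fin (#E + #E)
  code d = codeFrom d (edge-cases d)

  dartAt-↑ˡ : ∀ k → dartAt (k ↑ˡ #E) ≡ edgeDart k
  dartAt-↑ˡ k = cong [ edgeDart , rev ∘ edgeDart ]′ (splitAt-↑ˡ #E k #E)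

  dartAt-↑ʳ : ∀ k → dartAt (#E ↑ʳ k) ≡ rev (edgeDart k)
  dartAt-↑ʳ k = cong [ edgeDart , rev ∘ edgeDart ]′ (splitAt-↑ʳ #E #E k)

  dartAt-code : ∀ d → dartAt (code d) ≡ d
  dartAt-code d with edge-cases d
  ... | inj₁ h = trans (dartAt-↑ˡ (edgeOf d)) (sym h)
  ... | inj₂ h = trans (dartAt-↑ʳ (edgeOf d)) (sym h)

  dartAt-injective : ∀ i j → dartAt i ≡ dartAt j → i ≡ j
  dartAt-injective i j h with splitAt #E i in ei | splitAt #E j in ej
  ... | inj₁ k | inj₁ l = trans (sym (unsplit ei)) (trans (cong (_↑ˡ #E)
          (trans (sym (edge-edgeDart k)) (trans (cong edgeOf h) (edge-edgeDart l)))) (unsplit ej))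
    where
    unsplit : ∀ {i k} → splitAt #E i ≡ inj₁ k → k ↑ˡ #E ≡ i
    unsplit {i} e = trans (cong [ _↑ˡ #E , #E ↑ʳ_ ]′ (sym e)) (join-splitAt #E #E i)
  ... | inj₂ k | inj₂ l = trans (sym (unsplit ei)) (trans (cong (#E ↑ʳ_)
          (trans (sym (edge-edgeDart k)) (trans (sym (edgeOf-rev _)) (trans (cong edgeOf h) (trans (edgeOf-rev _) (edge-edgeDart l)))))) (unsplit ej))
    where
    unsplit : ∀ {i k} → splitAt #E i ≡ inj₂ k → #E ↑ʳ k ≡ i
    unsplit {i} e = trans (cong [ _↑ˡ #E , #E ↑ʳ_ ]′ (sym e)) (join-splitAt #E #E i)
  ... | inj₁ k | inj₂ l = ⊥-elim (rev-≢ (edgeDart l) (trans (cong edgeDart (sym k≡l)) h))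
    where
    k≡l : k ≡ l
    k≡l = trans (sym (edge-edgeDart k)) (trans (cong edgeOf h) (trans (edgeOf-rev _) (edge-edgeDart l)))
  ... | inj₂ k | inj₁ l = ⊥-elim (rev-≢ (edgeDart k) (trans (cong edgeDart k≡l) (sym h)))
    where
    k≡l : k ≡ l
    k≡l = trans (sym (edge-edgeDart k)) (trans (sym (edgeOf-rev _)) (trans (cong edgeOf h) (edge-edgeDart l)))

  unface : Dart G → Dart G
  unface = rev ∘ Inverse.from rotation

  face-unface : ∀ d → face (unface d) ≡ d
  face-unface d = trans (cong next (rev-rev _)) (Inverse.inverseˡ rotation refl)

  unface-face : ∀ d → unface (face d) ≡ d
  unface-face d = trans (cong rev (Inverse.inverseʳ rotation refl)) (rev-rev d)

  dartSum : (Dart G → ℕ) → ℕ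
  dartSum h = ∑ (λ k → h (edgeDart k) + h (rev (edgeDart k)))

  dartSum-dartAt : ∀ h → dartSum h ≡ ∑ (h ∘ dartAt)
  dartSum-dartAt h = begin
    dartSum h                                                    ≡⟨ ∑-distrib-+ (h ∘ edgeDart) (h ∘ rev ∘ edgeDart) ⟩
    ∑ (h ∘ edgeDart) + ∑ (h ∘ rev ∘ edgeDart)                    ≡⟨ cong₂ _+_ (sum-cong-≗ λ k → cong h (sym (dartAt-↑ˡ k)))
                                                                             (sum-cong-≗ λ k → cong h (sym (dartAt-↑ʳ k))) ⟩
    ∑ (λ k → h (dartAt (k ↑ˡ #E))) + ∑ (λ k → h (dartAt (#E ↑ʳ k))) ≡⟨ sym (∑-↑ #E (h ∘ dartAt)) ⟩
    ∑ (h ∘ dartAt)                                               ∎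
    where open ≡-Reasoning

  dartSum-face : ∀ h → dartSum (h ∘ face) ≡ dartSum h
  dartSum-face h = begin
    dartSum (h ∘ face)                    ≡⟨ dartSum-dartAt (h ∘ face) ⟩
    ∑ (λ i → h (face (dartAt i)))         ≡⟨ sum-cong-≗ (λ i → cong h (sym (dartAt-code (face (dartAt i))))) ⟩
    ∑ (λ i → h (dartAt (π i)))            ≡⟨ sym (sum-permute (h ∘ dartAt) (permutation π π⁻¹ inverseˡ inverseʳ)) ⟩
    ∑ (h ∘ dartAt)                        ≡⟨ sym (dartSum-dartAt h) ⟩
    dartSum h                             ∎
    where
    open ≡-Reasoning
    π π⁻¹ : Fin (#E + #E) → Fin (#E + #E)
    π   = code ∘ face ∘ dartAt
    π⁻¹ = code ∘ unface ∘ dartAt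
    inverseˡ : ∀ i → π (π⁻¹ i) ≡ i
    inverseˡ i = dartAt-injective _ _ (trans (dartAt-code _) (trans (cong face (dartAt-code _)) (face-unface (dartAt i))))
    inverseʳ : ∀ i → π⁻¹ (π i) ≡ i
    inverseʳ i = dartAt-injective _ _ (trans (dartAt-code _) (trans (cong unface (dartAt-code _)) (unface-face (dartAt i))))

  -- The bijection  face  preserves  χ  and turns targets into sources.
  dartSum-flow : ∀ (χ U : Dart G → ℕ) → (∀ d → χ (face d) ≡ χ d) → (∀ d → U (next d) ≡ U d) →
    dartSum (λ d → χ d * U d) ≡ dartSum (λ d → χ d * U (rev d))
  dartSum-flow χ U χ-face U-next = trans (sym (dartSum-face (λ d → χ d * U d)))
    (sum-cong-≗ λ k → cong₂ _+_ (eq (edgeDart k)) (eq (rev (edgeDart k))))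
    where
    eq : ∀ d → χ (face d) * U (face d) ≡ χ d * U (rev d)
    eq d = cong₂ _*_ (χ-face d) (U-next (rev d))

-- Regions of an induced subgraph

T-∧-left : ∀ {a b} → T (a ∧ b) → T a
T-∧-left {true} _ = tt

T-∧-right : ∀ {a b} → T (a ∧ b) → T b
T-∧-right {true} h = h

T-∧-pair : ∀ {a b} → T a → T b → T (a ∧ b)
T-∧-pair {true} _ h = h

module Subgraph {n : ℕ} {G : Graph n} (planar : Planar G) (X : Fin n → Bool) where

  open Planar planar
  open Map planar

  kept : Fin #E → Bool
  kept k = X (src (edgeDart k)) ∧ X (tgt (edgeDart k))

  deleted : Fin #E → Bool
  deleted k = not (kept k)

  sides : Fin #E → Fin #F × Fin #F
  sides k = faceOf (edgeDart k) , faceOf (rev (edgeDart k))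

  ends : Fin #E → Fin #V × Fin #V
  ends k = vertexOf (edgeDart k) , vertexOf (rev (edgeDart k))

  -- The faces of the subgraph are the classes of faces of  G  joined across
  -- deleted edges.
  region : Fin #F → Fin #F
  region = mergeAll id deleted sides

  regionAbove : Fin #E → Fin #F → Fin #F
  regionAbove = mergedAbove id deleted sides

  -- The joining edges form a spanning forest of the deleted dual edges.
  joining : Fin #E → Bool
  joining = effective id deleted sides

  inX : Fin #V → Bool
  inX i = X (src (vertexDart i))

  collapse : Fin #V → Fin #V → Fin #V
  collapse x₀ i = if inX i then x₀ else i

  cutting : Fin #E → Bool
  cutting k = not (kept k) ∧ not (joining k)

  -- Contract  X  and all deleted edges that are not joining.
  cluster : Fin #V → Fin #V → Fin #V
  cluster x₀ = mergeAll (collapse x₀) cutting ends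

  inX-vertexOf : ∀ d → inX (vertexOf d) ≡ X (src d)
  inX-vertexOf d = cong X (vertexOf-src (vertex-vertexDart (vertexOf d)))

  collapse-in : ∀ x₀ {i} → T (inX i) → collapse x₀ i ≡ x₀
  collapse-in x₀ {i} h with inX i
  ... | true = refl

  collapse-idempotent : ∀ x₀ → T (inX x₀) → Idempotent (collapse x₀)
  collapse-idempotent x₀ h i with inX i in eq
  ... | true  = collapse-in x₀ h
  ... | false rewrite eq = refl

  -- A kept edge lies inside the contracted set `X`; a deleted edge that does not join is contracted
  -- itself.
  not-joining : ∀ x₀ k → ¬ T (joining k) →
    cluster x₀ (vertexOf (edgeDart k)) ≡ cluster x₀ (vertexOf (rev (edgeDart k)))
  not-joining x₀ k h with T? (kept k)
  ... | yes both = mergeAll-respects (collapse x₀) cutting ends (trans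
          (collapse-in x₀ (subst T (sym (inX-vertexOf (edgeDart k))) (T-∧-left both)))
          (sym (collapse-in x₀ (subst T (sym (inX-vertexOf (rev (edgeDart k)))) (T-∧-right {X (src (edgeDart k))} both)))))
  ... | no ¬both = mergeAll-joins (collapse x₀) cutting ends k (T-∧-pair (T-not ¬both) (T-not h))

  -- Otherwise let  U  be the cluster of one end and  χ  the region of one side
  -- of the edge  k  just before it is joined: all other edges contribute
  -- nothing to the flow of  χ  out of  U,  but  k  does.
  joining-same : ∀ x₀ k → Acc _<ᶠ_ k →
    cluster x₀ (vertexOf (edgeDart k)) ≡ cluster x₀ (vertexOf (rev (edgeDart k)))
  joining-same x₀ k (acc smaller) with T? (joining k)
  ... | no h = not-joining x₀ k h
  ... | yes joins with cluster x₀ (vertexOf (edgeDart k)) ≟ cluster x₀ (vertexOf (rev (edgeDart k)))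
  ...   | yes e = e
  ...   | no apart = ⊥-elim (1≢0 (trans (sym at-left) (trans (∑-single-≡ k flow balanced) at-right)))
    where
    d₀ = edgeDart k
    χ U : Dart G → ℕ
    χ d = δ (regionAbove k (faceOf d)) (regionAbove k (faceOf d₀))
    U d = δ (cluster x₀ (vertexOf d)) (cluster x₀ (vertexOf d₀))
    left right : Fin #E → ℕ
    left  l = χ (edgeDart l) * U (edgeDart l) + χ (rev (edgeDart l)) * U (rev (edgeDart l))
    right l = χ (edgeDart l) * U (rev (edgeDart l)) + χ (rev (edgeDart l)) * U (rev (rev (edgeDart l)))
    flow : ∑ left ≡ ∑ right
    flow = dartSum-flow χ U
      (λ d → cong (λ f → δ (regionAbove k f) (regionAbove k (faceOf d₀))) (faceOf-face d))
      (λ d → cong (λ v → δ (cluster x₀ v) (cluster x₀ (vertexOf d₀))) (vertexOf-≡ (src-next d)))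
    same-cluster : ∀ l → cluster x₀ (vertexOf (edgeDart l)) ≡ cluster x₀ (vertexOf (rev (edgeDart l))) → left l ≡ right l
    same-cluster l e = cong₂ _+_
      (cong (λ v → χ (edgeDart l) * δ v (cluster x₀ (vertexOf d₀))) e)
      (cong (λ v → χ (rev (edgeDart l)) * δ v (cluster x₀ (vertexOf d₀)))
        (trans (sym e) (cong (λ d → cluster x₀ (vertexOf d)) (sym (rev-rev (edgeDart l))))))
    -- Edges of smaller index have both ends in one cluster by induction. Joining edges of larger
    -- index are already merged in `regionAbove k`, so their two darts contribute equally in both
    -- directions. All others lie within a cluster.
    balanced : ∀ l → l ≢ k → left l ≡ right l
    balanced l l≢k with <ᶠ-cmp l k
    ... | tri≈ _ e _ = ⊥-elim (l≢k e)
    ... | tri< l<k _ _ = same-cluster l (joining-same x₀ l (smaller l<k))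
    ... | tri> _ _ k<l with T? (joining l)
    ...   | no h = same-cluster l (not-joining x₀ l h)
    ...   | yes h = trans (cong (χ (edgeDart l) * U (edgeDart l) +_) (cong (_* U (rev (edgeDart l))) (sym χ-same)))
          (trans (+-comm (χ (edgeDart l) * U (edgeDart l)) _)
            (cong (χ (edgeDart l) * U (rev (edgeDart l)) +_)
              (cong₂ _*_ χ-same (cong U (sym (rev-rev (edgeDart l)))))))
      where
      χ-same : χ (edgeDart l) ≡ χ (rev (edgeDart l))
      χ-same = cong (λ f → δ f (regionAbove k (faceOf d₀)))
        (mergedAbove-joins id deleted sides k<l (effective≤ id deleted sides l h))
    1≢0 : 1 ≢ 0
    1≢0 ()
    χ₁ : χ d₀ ≡ 1
    χ₁ = δ-refl (regionAbove k (faceOf d₀))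
    χ₀ : χ (rev d₀) ≡ 0
    χ₀ = δ-≢ λ e → does-false (regionAbove k (faceOf d₀) ≟ regionAbove k (faceOf (rev d₀)))
           (T-∧-right {deleted k} joins) (sym e)
    at-left : left k ≡ 1
    at-left = cong₂ _+_ (cong₂ _*_ χ₁ (δ-refl (cluster x₀ (vertexOf d₀)))) (cong (_* U (rev d₀)) χ₀)
    at-right : right k ≡ 0
    at-right = cong₂ _+_ (trans (cong₂ _*_ χ₁ (δ-≢ (apart ∘ sym))) refl) (cong (_* U (rev (rev d₀))) χ₀)

  cluster-edge : ∀ x₀ d → cluster x₀ (vertexOf d) ≡ cluster x₀ (vertexOf (rev d))
  cluster-edge x₀ d with edge-cases d | joining-same x₀ (edgeOf d) (<-wellFounded (edgeOf d))
  ... | inj₁ h | e = subst (λ d → cluster x₀ (vertexOf d) ≡ cluster x₀ (vertexOf (rev d))) (sym h) e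
  ... | inj₂ h | e = subst (λ d → cluster x₀ (vertexOf d) ≡ cluster x₀ (vertexOf (rev d))) (sym h)
          (trans (sym e) (cong (λ d → cluster x₀ (vertexOf d)) (sym (rev-rev _))))

  cluster-walk : ∀ x₀ {u v} → Walk (Adj G) u v → ∀ {a b} → src a ≡ u → src b ≡ v →
    cluster x₀ (vertexOf a) ≡ cluster x₀ (vertexOf b)
  cluster-walk x₀ ε ea eb = cong (cluster x₀) (vertexOf-≡ (trans ea (sym eb)))
  cluster-walk x₀ {u} (_◅_ {j = w} uw s) ea eb = trans (cong (cluster x₀) (vertexOf-≡ {e = dart u w uw} ea))
    (trans (cluster-edge x₀ (dart u w uw)) (cluster-walk x₀ s {rev (dart u w uw)} refl eb))

  -- By `cluster-edge` even the joining edges stay within a cluster, so clusters are unions of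
  -- components: leaving out the joining edges disconnects nothing.
  cluster-fixedPoints : ∀ x₀ → fixedPoints (cluster x₀) ≤ #C
  cluster-fixedPoints x₀ = ≤-trans
    (∑-injective (fixed (cluster x₀)) (λ _ → 1) (componentOf ∘ vertexDart) inj (λ _ _ → ≤-refl))
    (≤-reflexive (trans (∑-const #C 1) (*-identityʳ #C)))
    where
    inj : ∀ i j → T (fixed (cluster x₀) i) → T (fixed (cluster x₀) j) →
      componentOf (vertexDart i) ≡ componentOf (vertexDart j) → i ≡ j
    inj i j fi fj e = trans (sym (does-true (cluster x₀ i ≟ i) fi)) (trans
      (subst₂ (λ a b → cluster x₀ a ≡ cluster x₀ b) (vertex-vertexDart i) (vertex-vertexDart j)
        (cluster-walk x₀ (component-related e) refl refl))
      (does-true (cluster x₀ j ≟ j) fj))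

  #X #K : ℕ
  #X = ∑ (λ i → [ inX i ])
  #K = ∑ (λ k → [ kept k ])

  collapse-fixedPoints : ∀ x₀ → T (inX x₀) → suc #V ≤ fixedPoints (collapse x₀) + #X
  collapse-fixedPoints x₀ h = begin
    suc #V                                                 ≡⟨ +-comm 1 #V ⟩
    #V + 1                                                 ≡⟨ sym (cong₂ _+_ (trans (∑-const #V 1) (*-identityʳ #V)) (∑-δ1 x₀)) ⟩
    ∑ {#V} (λ _ → 1) + ∑ (δ x₀)                            ≡⟨ sym (∑-distrib-+ {#V} (λ _ → 1) (δ x₀)) ⟩
    ∑ (λ i → 1 + δ x₀ i)                                   ≤⟨ ∑-mono pointwise ⟩
    ∑ (λ i → [ fixed (collapse x₀) i ] + [ inX i ])        ≡⟨ ∑-distrib-+ (λ i → [ fixed (collapse x₀) i ]) _ ⟩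
    fixedPoints (collapse x₀) + #X                         ∎
    where
    open ≤-Reasoning
    pointwise : ∀ i → 1 + δ x₀ i ≤ [ fixed (collapse x₀) i ] + [ inX i ]
    pointwise i with inX i in eq
    ... | true  = ≤-reflexive (+-comm 1 (δ x₀ i))
    ... | false = ≤-reflexive (cong₂ _+_ (sym (δ-refl i))
            (δ-≢ λ e → subst T eq (subst (T ∘ inX) e h)))

  -- Euler's inequality for the subgraph, with  X  counted as one component.
  region-bound : ∀ x₀ → T (inX x₀) → suc (#K + #C) ≤ fixedPoints region + #X
  -- Joining edges pay for merged faces and cutting edges for merged vertices, so `#J` and `#R`
  -- cancel.
  region-bound x₀ h = +-cancelʳ-≤ (#J + #R + #C) _ _ (begin
    suc (#K + #C) + (#J + #R + #C)              ≡⟨ solve 4 (λ k c j r → con 1 :+ (k :+ c) :+ (j :+ r :+ c) := con 1 :+ ((k :+ (j :+ r)) :+ con 2 :* c)) refl #K #C #J #R ⟩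
    suc (#K + (#J + #R) + 2 * #C)               ≤⟨ s≤s (+-monoˡ-≤ (2 * #C) edges-split) ⟩
    suc (#E + 2 * #C)                           ≡⟨ cong suc (sym euler) ⟩
    suc #V + #F                                 ≤⟨ +-mono-≤ (collapse-fixedPoints x₀ h) faces-bound ⟩
    fixedPoints (collapse x₀) + #X + (fixedPoints region + #J)
                                                ≤⟨ +-monoˡ-≤ _ (+-monoˡ-≤ #X vertices-bound) ⟩
    #C + #R + #X + (fixedPoints region + #J)    ≡⟨ solve 5 (λ c r x f j → c :+ r :+ x :+ (f :+ j) := f :+ x :+ (j :+ r :+ c)) refl #C #R #X (fixedPoints region) #J ⟩
    fixedPoints region + #X + (#J + #R + #C)    ∎)
    where
    open ≤-Reasoning
    open +-*-Solver
    #J #R : ℕ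
    #J = ∑ (λ k → [ joining k ])
    #R = ∑ (λ k → [ cutting k ])
    edges-split : #K + (#J + #R) ≤ #E
    edges-split = begin
      #K + (#J + #R)                                          ≡⟨ cong (#K +_) (sym (∑-distrib-+ (λ k → [ joining k ]) _)) ⟩
      #K + ∑ (λ k → [ joining k ] + [ cutting k ])            ≡⟨ sym (∑-distrib-+ (λ k → [ kept k ]) _) ⟩
      ∑ (λ k → [ kept k ] + ([ joining k ] + [ cutting k ]))  ≤⟨ ∑-mono one ⟩
      ∑ {#E} (λ _ → 1)                                        ≡⟨ trans (∑-const #E 1) (*-identityʳ #E) ⟩
      #E                                                      ∎
      where
      one : ∀ k → [ kept k ] + ([ joining k ] + [ cutting k ]) ≤ 1
      one k with kept k | does (regionAbove k (proj₁ (sides k)) ≟ regionAbove k (proj₂ (sides k)))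
      ... | true  | _     = ≤-refl
      ... | false | true  = ≤-refl
      ... | false | false = ≤-refl
    faces-bound : #F ≤ fixedPoints region + #J
    faces-bound = ≤-trans (≤-reflexive (sym (trans (sum-cong-≗ {#F} δ-refl) (trans (∑-const #F 1) (*-identityʳ #F)))))
      (mergeAll-fixedPoints id deleted sides λ _ → refl)
    vertices-bound : fixedPoints (collapse x₀) ≤ #C + #R
    vertices-bound = ≤-trans (mergeAll-fixedPoints (collapse x₀) cutting ends (collapse-idempotent x₀ h))
      (+-mono-≤ (cluster-fixedPoints x₀) (∑-mono λ k → []-mono (effective≤ (collapse x₀) cutting ends k)))

-- Cycles bounding a region

xor-≢ : ∀ {a b} → T (a xor b) → a ≢ b
xor-≢ {true}  {false} _ ()
xor-≢ {false} {true}  _ ()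

¬xor-≡ : ∀ {a b} → ¬ T (a xor b) → a ≡ b
¬xor-≡ {true}  {true}  _ = refl
¬xor-≡ {true}  {false} h = ⊥-elim (h tt)
¬xor-≡ {false} {true}  h = ⊥-elim (h tt)
¬xor-≡ {false} {false} _ = refl

module _ {n : ℕ} (G : Graph n) (X : Fin n → Bool) where

  degreeIn : Fin n → ℕ
  degreeIn v = ∑ (λ w → [ adj G v w ∧ X w ])

  branching : Fin n → Bool
  branching v = does (degreeIn v ≟ⁿ 3)

  SparseCycle : Set
  SparseCycle = ∃₂ λ m (Z : Cycle G m) → (∀ i → T (X (Cycle.vertex Z i))) ×
    ∑ (λ i → [ branching (Cycle.vertex Z i) ]) ≤ 5

module Boundary {n : ℕ} {G : Graph n} (planar : Planar G) (X : Fin n → Bool) where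

  open Planar planar
  open Map planar
  open Subgraph planar X

  regionOf : Dart G → Fin #F
  regionOf d = region (faceOf d)

  side : Fin #F → Dart G → Bool
  side f d = does (regionOf d ≟ f)

  boundary : Fin #F → Dart G → Bool
  boundary f d = side f d xor side f (rev d)

  side-next : ∀ f d → side f (next d) ≡ side f (rev d)
  side-next f d = cong (λ g → does (region g ≟ f)) (faceOf-next d)

  -- The two sides of a deleted edge have been merged into one region, so no boundary runs along it.
  boundary-inside : ∀ f d → T (boundary f d) → T (X (src d)) × T (X (tgt d))
  boundary-inside f d h with T? (kept (edgeOf d)) | edge-cases d
  ... | yes k | inj₁ e = subst (T ∘ X ∘ src) (sym e) (T-∧-left k) , subst (T ∘ X ∘ tgt) (sym e) (T-∧-right {X (src (edgeDart (edgeOf d)))} k)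
  ... | yes k | inj₂ e = subst (T ∘ X ∘ src) (sym e) (T-∧-right {X (src (edgeDart (edgeOf d)))} k) , subst (T ∘ X ∘ tgt) (sym e) (T-∧-left k)
  ... | no ¬k | c = ⊥-elim (xor-≢ h (cong (λ g → does (g ≟ f)) (joined c)))
    where
    join : regionOf (edgeDart (edgeOf d)) ≡ regionOf (rev (edgeDart (edgeOf d)))
    join = mergeAll-joins id deleted sides (edgeOf d) (T-not ¬k)
    joined : d ≡ edgeDart (edgeOf d) ⊎ d ≡ rev (edgeDart (edgeOf d)) → regionOf d ≡ regionOf (rev d)
    joined (inj₁ e) = subst (λ d → regionOf d ≡ regionOf (rev d)) (sym e) join
    joined (inj₂ e) = subst (λ d → regionOf d ≡ regionOf (rev d)) (sym e)
      (trans (sym join) (cong regionOf (sym (rev-rev (edgeDart (edgeOf d))))))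

  -- Turning around a vertex, one cannot enter a region without leaving it.
  turn : ∀ f {d e} → SameOrbit next e d → side f e ≢ side f d →
    ∃ λ e′ → src e′ ≡ src d × T (boundary f e′) × e′ ≢ d
  turn f ε h = ⊥-elim (h refl)
  turn f {d} {e} s@(refl ◅ s′) h with T? (boundary f e)
  ... | yes b = e , Equivalence.from (vertexOrbits e d) s , b , λ { refl → h refl }
  ... | no ¬b = turn f s′ λ e → h (trans (¬xor-≡ ¬b) (trans (sym (side-next f _)) e))

  -- The rotation at the target of `d` begins just after `rev d` on the side of `d` and returns to
  -- `rev d` on the other side. `turn` finds a crossing different from `rev d`, so the walk does not
  -- turn back.
  advance : ∀ f d → T (boundary f d) → ∃ λ e → T (boundary f e) × src e ≡ tgt d × tgt e ≢ src d
  advance f d h with turn f (Equivalence.to (vertexOrbits (next (rev d)) (rev d)) (src-next (rev d)))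
    (λ e → xor-≢ h (sym (trans (sym e) (trans (side-next f (rev d)) (cong (side f) (rev-rev d))))))
  ... | e , s , b , e≢ = e , b , s , λ t → e≢ (dart-≡ s t)

  HasBoundary : Fin #F → Set
  HasBoundary f = ∃ λ k → T (boundary f (edgeDart k))

  hasBoundary? : ∀ f → Dec (HasBoundary f)
  hasBoundary? f = any? λ k → T? (boundary f (edgeDart k))

  module Closed (f : Fin #F) (closed : ¬ HasBoundary f) where

    side-rev : ∀ d → side f d ≡ side f (rev d)
    side-rev d with edge-cases d
    ... | inj₁ e = subst (λ d → side f d ≡ side f (rev d)) (sym e) (¬xor-≡ λ b → closed (edgeOf d , b))
    ... | inj₂ e = subst (λ d → side f d ≡ side f (rev d)) (sym e)
      (trans (sym (¬xor-≡ λ b → closed (edgeOf d , b))) (cong (side f) (sym (rev-rev _))))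

    side-orbit : ∀ {d e} → SameOrbit next d e → side f d ≡ side f e
    side-orbit ε = refl
    side-orbit {d} (refl ◅ s) = trans (side-rev d) (trans (sym (side-next f d)) (side-orbit s))

    side-vertex : ∀ {d e} → src d ≡ src e → side f d ≡ side f e
    side-vertex {d} {e} h = side-orbit (Equivalence.to (vertexOrbits d e) h)

    side-walk : ∀ {u v} → Walk (Adj G) u v → ∀ {d e} → src d ≡ u → src e ≡ v → side f d ≡ side f e
    side-walk ε ed ee = side-vertex (trans ed (sym ee))
    side-walk {u} (_◅_ {j = w} uw s) ed ee = trans (side-vertex {e = dart u w uw} ed)
      (trans (side-rev (dart u w uw)) (side-walk s {rev (dart u w uw)} refl ee))

  closed : Fin #F → Bool
  closed f = fixed region f ∧ not (does (hasBoundary? f))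

  closed-sound : ∀ {f} → T (closed f) → region f ≡ f × ¬ HasBoundary f
  closed-sound {f} h = does-true (region f ≟ f) (T-∧-left h) , does-false (hasBoundary? f) (T-∧-right {fixed region f} h)

  -- A region without boundary is a whole component.
  closed-bound : ∑ (λ f → [ closed f ]) ≤ #C
  closed-bound = ≤-trans (∑-injective closed (λ _ → 1) (componentOf ∘ faceDart) inj (λ _ _ → ≤-refl))
    (≤-reflexive (trans (∑-const #C 1) (*-identityʳ #C)))
    where
    own : ∀ f → region f ≡ f → regionOf (faceDart f) ≡ f
    own f e = trans (cong region (face-faceDart f)) e
    inj : ∀ f g → T (closed f) → T (closed g) → componentOf (faceDart f) ≡ componentOf (faceDart g) → f ≡ g
    inj f g hf hg e = trans (sym (does-true (regionOf (faceDart g) ≟ f) in-f)) (own g (proj₁ (closed-sound {g} hg)))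
      where
      open Closed f (proj₂ (closed-sound {f} hf))
      in-f : T (side f (faceDart g))
      in-f = subst T (side-walk (component-related e) refl refl)
        (does-sound (regionOf (faceDart f) ≟ f) (own f (proj₁ (closed-sound {f} hf))))

  hitBy : ∀ f v w → Dec (Adj G v w) → ℕ
  hitBy f v w (yes p) = [ side f (dart v w p) ]
  hitBy f v w (no _)  = 0

  hit : Fin #F → Fin n → Fin n → ℕ
  hit f v w = hitBy f v w (T? (adj G v w))

  -- The number of corners of the region `f` at `v`, one for each outgoing dart.
  incidence : Fin #F → Fin n → ℕ
  incidence f v = ∑ (hit f v)

  hit-side : ∀ f d → T (side f d) → 1 ≤ hit f (src d) (tgt d)
  hit-side f d@(dart v w p) h with T? (adj G v w)
  ... | yes q = ≤-reflexive (sym (T⇒[]≡1 (subst (T ∘ side f) (dart-≡ refl refl) h)))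
  ... | no ¬p = ⊥-elim (¬p p)

  incidence-side : ∀ f d → T (side f d) → 1 ≤ incidence f (src d)
  incidence-side f d h = ≤-trans (hit-side f d h) (term≤∑ (hit f (src d)) (tgt d))

  -- Exactly one of `d` and `rev d` is on the side of `f`; in the second case `next d`, which has
  -- the same source as `d`, lies in the face of `rev d`.
  incidence-boundary : ∀ f d → T (boundary f d) → 1 ≤ incidence f (src d)
  incidence-boundary f d h with T? (side f d)
  ... | yes s = incidence-side f d s
  ... | no ¬s = subst (λ v → 1 ≤ incidence f v) (src-next d)
        (incidence-side f (next d) (subst T (sym (side-next f d)) (opposite-side (side f d) _ ¬s h)))
    where
    opposite-side : ∀ a b → ¬ T a → T (a xor b) → T b
    opposite-side true  _ h _ = ⊥-elim (h tt)
    opposite-side false _ _ b = b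

  incidence-total : ∀ v → ∑ (λ f → incidence f v) ≤ ∑ (λ w → [ adj G v w ])
  incidence-total v = ≤-trans (≤-reflexive (∑-comm (λ f w → hit f v w))) (∑-mono column)
    where
    column : ∀ w → ∑ (λ f → hit f v w) ≤ [ adj G v w ]
    column w with T? (adj G v w)
    ... | yes p = ≤-reflexive (trans (∑-δ1 (regionOf (dart v w p))) (sym (T⇒[]≡1 p)))
    ... | no _  = ≤-trans (≤-reflexive (∑-zero {#F} λ _ → refl)) z≤n

  branch : Fin n → Bool
  branch v = X v ∧ branching G X v

  weight : Fin #F → ℕ
  weight f = ∑ (λ v → [ branch v ] * incidence f v)

  #B : ℕ
  #B = ∑ (λ v → [ branch v ])

  weight-total : Subcubic G → ∑ weight ≤ 3 * #B
  weight-total subcubic = begin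
    ∑ weight                                                   ≡⟨ ∑-comm (λ f v → [ branch v ] * incidence f v) ⟩
    ∑ (λ v → ∑ (λ f → [ branch v ] * incidence f v))           ≡⟨ sum-cong-≗ (λ v → ∑-*ˡ [ branch v ] (λ f → incidence f v)) ⟩
    ∑ (λ v → [ branch v ] * ∑ (λ f → incidence f v))           ≤⟨ ∑-mono (λ v → *-monoʳ-≤ [ branch v ] (≤-trans (incidence-total v)
                                                                    (subst (_≤ 3) (∣tabulate∣ (adj G v)) (subcubic v)))) ⟩
    ∑ (λ v → [ branch v ] * 3)                                 ≡⟨ sum-cong-≗ (λ v → *-comm [ branch v ] 3) ⟩
    ∑ (λ v → 3 * [ branch v ])                                 ≡⟨ ∑-*ˡ 3 (λ v → [ branch v ]) ⟩
    3 * #B                                                     ∎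
    where open ≤-Reasoning

  branches : ∀ {m} → Cycle G m → ℕ
  branches Z = ∑ (λ i → [ branching G X (Cycle.vertex Z i) ])

  BoundaryCycle : Fin #F → Set
  BoundaryCycle f = ∃₂ λ m (Z : Cycle G m) → ∀ i → ∃ λ e → T (boundary f e) × src e ≡ Cycle.vertex Z i

  boundaryCycle-inside : ∀ f (Z : BoundaryCycle f) i → T (X (Cycle.vertex (proj₁ (proj₂ Z)) i))
  boundaryCycle-inside f (m , Z , on) i =
    subst (T ∘ X) (proj₂ (proj₂ (on i))) (proj₁ (boundary-inside f (proj₁ (on i)) (proj₁ (proj₂ (on i)))))

  -- The vertices of the cycle are distinct, and each branching one has at least one corner in `f`.
  boundaryCycle-weight : ∀ f (Z : BoundaryCycle f) → branches (proj₁ (proj₂ Z)) ≤ weight f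
  boundaryCycle-weight f C@(m , Z , on) =
    ∑-injective (λ i → branching G X (Cycle.vertex Z i)) (λ v → [ branch v ] * incidence f v)
      (Cycle.vertex Z) (λ i j _ _ → Cycle.injective Z) heavy
    where
    heavy : ∀ i → T (branching G X (Cycle.vertex Z i)) → 1 ≤ [ branch (Cycle.vertex Z i) ] * incidence f (Cycle.vertex Z i)
    heavy i h = ≤-trans
      (subst (λ v → 1 ≤ incidence f v) (proj₂ (proj₂ (on i))) (incidence-boundary f (proj₁ (on i)) (proj₁ (proj₂ (on i)))))
      (≤-reflexive (sym (trans (cong (_* incidence f (Cycle.vertex Z i))
        (T⇒[]≡1 (T-∧-pair {X (Cycle.vertex Z i)} (boundaryCycle-inside f C i) h))) (*-identityˡ _))))

  -- A region with a boundary yields one boundary cycle; either that cycle is sparse, or its six or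
  -- more branching vertices make the region heavy.
  classify : ∀ f → (HasBoundary f → 6 ≤ weight f) ⊎ SparseCycle G X
  classify f = decide (hasBoundary? f)
    where
    compare : (Z : BoundaryCycle f) → Dec (branches (proj₁ (proj₂ Z)) ≤ 5) → (HasBoundary f → 6 ≤ weight f) ⊎ SparseCycle G X
    compare C@(m , Z , on) (yes few) = inj₂ (m , Z , boundaryCycle-inside f C , few)
    compare C (no many) = inj₁ λ _ → ≤-trans (≰⇒> many) (boundaryCycle-weight f C)
    decide : Dec (HasBoundary f) → (HasBoundary f → 6 ≤ weight f) ⊎ SparseCycle G X
    decide (no none) = inj₁ λ b → ⊥-elim (none b)
    decide (yes (k , b)) = compare C (branches (proj₁ (proj₂ C)) ≤? 5)
      where
      C : BoundaryCycle f
      C = dart-cycle (boundary f) (advance f) (edgeDart k) b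

  pair : Fin n → Fin n → Fin n → Fin n → ℕ
  pair a b v w = δ a v * δ b w

  ∑-pair : ∀ a b → ∑ (λ v → ∑ (pair a b v)) ≡ 1
  ∑-pair a b = trans (sum-cong-≗ λ v → trans (∑-*ˡ (δ a v) (δ b)) (cong (δ a v *_) (∑-δ1 b))) (∑-δ a (λ _ → 1))

  -- Each ordered pair of adjacent vertices in `X` is one of the two orientations of a kept edge.
  degree-total : ∑ (λ v → [ X v ] * degreeIn G X v) ≤ #K * 2
  degree-total = begin
    ∑ (λ v → [ X v ] * degreeIn G X v)          ≡⟨ sum-cong-≗ (λ v → sym (∑-*ˡ [ X v ] (λ w → [ adj G v w ∧ X w ]))) ⟩
    ∑ (λ v → ∑ (λ w → [ X v ] * [ adj G v w ∧ X w ])) ≤⟨ ∑-mono (λ v → ∑-mono (λ w → dart-counted v w)) ⟩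
    ∑ (λ v → ∑ (λ w → ∑ (λ k → term k v w)))    ≡⟨ sum-cong-≗ (λ v → ∑-comm (λ w k → term k v w)) ⟩
    ∑ (λ v → ∑ (λ k → ∑ (λ w → term k v w)))    ≡⟨ ∑-comm (λ v k → ∑ (λ w → term k v w)) ⟩
    ∑ (λ k → ∑ (λ v → ∑ (λ w → term k v w)))    ≡⟨ sum-cong-≗ total ⟩
    ∑ (λ k → 2 * [ kept k ])                    ≡⟨ ∑-*ˡ 2 (λ k → [ kept k ]) ⟩
    2 * #K                                      ≡⟨ *-comm 2 #K ⟩
    #K * 2                                      ∎
    where
    open ≤-Reasoning
    both : Fin #E → Fin n → Fin n → ℕ
    both k v w = pair (src (edgeDart k)) (tgt (edgeDart k)) v w + pair (tgt (edgeDart k)) (src (edgeDart k)) v w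
    term : Fin #E → Fin n → Fin n → ℕ
    term k v w = [ kept k ] * both k v w
    total : ∀ k → ∑ (λ v → ∑ (λ w → term k v w)) ≡ 2 * [ kept k ]
    total k = trans (sum-cong-≗ λ v → ∑-*ˡ [ kept k ] (both k v))
      (trans (∑-*ˡ [ kept k ] (λ v → ∑ (both k v)))
      (trans (cong ([ kept k ] *_) (trans (sum-cong-≗ λ v → ∑-distrib-+ (pair (src (edgeDart k)) (tgt (edgeDart k)) v) _)
         (trans (∑-distrib-+ (λ v → ∑ (pair (src (edgeDart k)) (tgt (edgeDart k)) v)) _)
           (cong₂ _+_ (∑-pair (src (edgeDart k)) (tgt (edgeDart k))) (∑-pair (tgt (edgeDart k)) (src (edgeDart k)))))))
      (*-comm [ kept k ] 2)))
    dart-counted : ∀ v w → [ X v ] * [ adj G v w ∧ X w ] ≤ ∑ (λ k → term k v w)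
    dart-counted v w with X v in xv | adj G v w in a | X w in xw
    ... | false | _     | _     = z≤n
    ... | true  | false | _     = z≤n
    ... | true  | true  | false = z≤n
    ... | true  | true  | true  = ≤-trans (≤-reflexive (sym one)) (term≤∑ (λ k → term k v w) k)
      where
      d : Dart G
      d = dart v w (subst T (sym a) tt)
      k = edgeOf d
      one : term k v w ≡ 1
      one with edge-cases d
      ... | inj₁ e = cong₂ _*_
              (T⇒[]≡1 {kept k} (T-∧-pair (subst T (trans (sym xv) (cong (X ∘ src) e)) tt) (subst T (trans (sym xw) (cong (X ∘ tgt) e)) tt)))
              (cong₂ _+_ (cong₂ _*_ (δ-≡ (cong src (sym e))) (δ-≡ (cong tgt (sym e))))
                (cong₂ _*_ (δ-≢ (λ h → src≢tgt d (trans (sym h) (cong tgt (sym e))))) refl))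
      ... | inj₂ e = cong₂ _*_
              (T⇒[]≡1 {kept k} (T-∧-pair (subst T (trans (sym xw) (cong (X ∘ tgt) e)) tt) (subst T (trans (sym xv) (cong (X ∘ src) e)) tt)))
              (cong₂ _+_ (cong₂ _*_ (δ-≢ (λ h → src≢tgt d (trans (sym h) (cong tgt (sym e))))) refl)
                (cong₂ _*_ (δ-≡ (cong src (sym e))) (δ-≡ (cong tgt (sym e)))))

  -- Vertex classes consist of darts, so `#X` misses the isolated vertices of `G`.
  vertices-bound : #X ≤ ∑ (λ v → [ X v ])
  vertices-bound = ∑-injective inX (λ v → [ X v ]) (src ∘ vertexDart)
    (λ i j _ _ e → trans (sym (vertex-vertexDart i)) (trans (vertexOf-≡ e) (vertex-vertexDart j)))
    (λ i h → ≤-reflexive (sym (T⇒[]≡1 h)))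

  -- If no sparse cycle is found, all regions with boundary are heavy, so `6 * #G` is at most
  -- `3 * #B`. Euler's inequality gives `suc #K` at most `#G + #X`, and the degrees give twice the
  -- size of `X` plus `#B` at most `#K * 2`. Together `2 + #K * 2` would be at most `#K * 2`.
  sparse-cycle : Subcubic G → (∀ v → T (X v) → 2 ≤ degreeIn G X v) → (∃ λ v → T (X v)) → SparseCycle G X
  sparse-cycle subcubic minimum (v , v∈X) with all-or-some classify
  ... | inj₂ found = found
  ... | inj₁ heavy = ⊥-elim (<-irrefl refl (≤-trans (n≤1+n _) (begin
      2 + #K * 2                               ≤⟨ *-monoˡ-≤ 2 few-edges ⟩
      (#G + #X) * 2                            ≡⟨ *-distribʳ-+ 2 #G #X ⟩
      #G * 2 + #X * 2                          ≤⟨ +-mono-≤ few-regions (*-monoˡ-≤ 2 vertices-bound) ⟩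
      #B + ∑ (λ v → [ X v ]) * 2               ≡⟨ +-comm #B _ ⟩
      ∑ (λ v → [ X v ]) * 2 + #B               ≡⟨ cong (_+ #B) (*-comm (∑ (λ v → [ X v ])) 2) ⟩
      2 * ∑ (λ v → [ X v ]) + #B               ≡⟨ cong (_+ #B) (sym (∑-*ˡ 2 (λ v → [ X v ]))) ⟩
      ∑ (λ v → 2 * [ X v ]) + #B               ≡⟨ sym (∑-distrib-+ (λ v → 2 * [ X v ]) (λ v → [ branch v ])) ⟩
      ∑ (λ v → 2 * [ X v ] + [ branch v ])     ≤⟨ ∑-mono degree-bound ⟩
      ∑ (λ v → [ X v ] * degreeIn G X v)       ≤⟨ degree-total ⟩
      #K * 2                                   ∎)))
    where
    open ≤-Reasoning
    open-region : Fin #F → Bool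
    open-region f = fixed region f ∧ does (hasBoundary? f)
    #G : ℕ
    #G = ∑ (λ f → [ open-region f ])
    degree-bound : ∀ v → 2 * [ X v ] + [ branch v ] ≤ [ X v ] * degreeIn G X v
    degree-bound v = bound (degreeIn G X v) (X v) (minimum v)
      where
      bound : ∀ d x → (T x → 2 ≤ d) → 2 * [ x ] + [ x ∧ does (d ≟ⁿ 3) ] ≤ [ x ] * d
      bound d false _ = z≤n
      bound d true  h with d ≡ᵇ 3 in eq
      ... | true  = ≤-reflexive (sym (trans (*-identityˡ d) (≡ᵇ⇒≡ d 3 (subst T (sym eq) tt))))
      ... | false = ≤-trans (h tt) (≤-reflexive (sym (*-identityˡ d)))
    few-regions : #G * 2 ≤ #B
    few-regions = *-cancelˡ-≤ 3 (begin
      3 * (#G * 2)        ≡⟨ trans (cong (3 *_) (*-comm #G 2)) (sym (*-assoc 3 2 #G)) ⟩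
      6 * #G              ≡⟨ sym (∑-*ˡ 6 (λ f → [ open-region f ])) ⟩
      ∑ (λ f → 6 * [ open-region f ]) ≤⟨ ∑-mono each ⟩
      ∑ weight            ≤⟨ weight-total subcubic ⟩
      3 * #B              ∎)
      where
      each : ∀ f → 6 * [ open-region f ] ≤ weight f
      each f with fixed region f | hasBoundary? f
      ... | false | _     = z≤n
      ... | true  | no _  = z≤n
      ... | true  | yes b = heavy f b
    regions-split : fixedPoints region ≤ #C + #G
    regions-split = begin
      fixedPoints region                                   ≤⟨ ∑-mono each ⟩
      ∑ (λ f → [ closed f ] + [ open-region f ])           ≡⟨ ∑-distrib-+ (λ f → [ closed f ]) _ ⟩
      ∑ (λ f → [ closed f ]) + #G                          ≤⟨ +-monoˡ-≤ #G closed-bound ⟩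
      #C + #G                                              ∎
      where
      each : ∀ f → [ fixed region f ] ≤ [ closed f ] + [ open-region f ]
      each f with fixed region f | does (hasBoundary? f)
      ... | false | _     = z≤n
      ... | true  | true  = ≤-refl
      ... | true  | false = ≤-refl
    -- `region-bound` needs a vertex of `X` that carries a dart; the minimum degree supplies one.
    node : ∃ λ i → T (inX i)
    node with ∑-positive (λ w → [ adj G v w ∧ X w ]) (≤-trans (s≤s z≤n) (minimum v v∈X))
    ... | w , h with adj G v w in a
    ...   | true = vertexOf (dart v w (subst T (sym a) tt)) ,
                   subst T (sym (inX-vertexOf (dart v w (subst T (sym a) tt)))) v∈X
    -- The regions without boundary number at most `#C` and are absorbed by the component term of
    -- `region-bound`.
    few-edges : suc #K ≤ #G + #X
    few-edges = +-cancelʳ-≤ #C _ _ (begin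
      suc (#K + #C)               ≤⟨ region-bound (proj₁ node) (proj₂ node) ⟩
      fixedPoints region + #X     ≤⟨ +-monoˡ-≤ #X regions-split ⟩
      #C + #G + #X                ≡⟨ trans (+-assoc #C #G #X) (+-comm #C _) ⟩
      #G + #X + #C                ∎)

-- The colouring

δ≤ : ∀ {n} (p : Fin n → Bool) {a} → T (p a) → ∀ w → δ a w ≤ [ p w ]
δ≤ p {a} pa w with a ≟ w
... | yes refl = ≤-reflexive (sym (T⇒[]≡1 pa))
... | no _     = z≤n

∑-two : ∀ {n} (p : Fin n → Bool) {a b} → T (p a) → T (p b) → a ≢ b → 2 ≤ ∑ (λ w → [ p w ])
∑-two p {a} {b} pa pb a≢b = ≤-trans
  (≤-reflexive (sym (trans (∑-distrib-+ (δ a) (δ b)) (cong₂ _+_ (∑-δ1 a) (∑-δ1 b))))) (∑-mono pointwise)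
  where
  pointwise : ∀ w → δ a w + δ b w ≤ [ p w ]
  pointwise w with a ≟ w
  ... | yes refl = ≤-reflexive (trans (cong suc (δ-≢ (a≢b ∘ sym))) (sym (T⇒[]≡1 pa)))
  ... | no _     = δ≤ p pb w

∑-three : ∀ {n} (p : Fin n → Bool) {a b c} → T (p a) → T (p b) → T (p c) →
  a ≢ b → a ≢ c → b ≢ c → 3 ≤ ∑ (λ w → [ p w ])
∑-three p {a} {b} {c} pa pb pc a≢b a≢c b≢c = ≤-trans
  (≤-reflexive (sym (trans (∑-distrib-+ (δ a) (λ w → δ b w + δ c w))
    (cong₂ _+_ (∑-δ1 a) (trans (∑-distrib-+ (δ b) (δ c)) (cong₂ _+_ (∑-δ1 b) (∑-δ1 c))))))) (∑-mono pointwise)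
  where
  pointwise : ∀ w → δ a w + (δ b w + δ c w) ≤ [ p w ]
  pointwise w with a ≟ w
  ... | yes refl = ≤-reflexive (trans (cong suc (cong₂ _+_ (δ-≢ (a≢b ∘ sym)) (δ-≢ (a≢c ∘ sym)))) (sym (T⇒[]≡1 pa)))
  ... | no _ with b ≟ w
  ...   | yes refl = ≤-reflexive (trans (cong suc (δ-≢ (b≢c ∘ sym))) (sym (T⇒[]≡1 pb)))
  ...   | no _     = δ≤ p pc w

module _ {n : ℕ} (G : Graph n) (subcubic : Subcubic G) (planar : Planar G) (girth : GirthAtLeast 16 G) where

  open Colouring G subcubic

  degreeIn≤3 : ∀ X v → degreeIn G X v ≤ 3
  degreeIn≤3 X v = ≤-trans (∑-mono λ w → []-mono (T-∧-left {adj G v w}))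
    (subst (_≤ 3) (∣tabulate∣ (adj G v)) (subcubic v))

  not-branching : ∀ X {v a b} → ¬ T (branching G X v) → T (X a) → Adj G v a → T (X b) → Adj G v b → a ≢ b →
    Thin G X v a b
  not-branching X {v} {a} {b} h a∈ va b∈ vb a≢b w w∈ vw with w ≟ a | w ≟ b
  ... | yes e | _     = inj₁ e
  ... | no _  | yes e = inj₂ e
  ... | no w≢a | no w≢b = ⊥-elim (h (does-sound (degreeIn G X v ≟ⁿ 3) (≤-antisym (degreeIn≤3 X v)
          (∑-three (λ w → adj G v w ∧ X w) (T-∧-pair va a∈) (T-∧-pair vb b∈) (T-∧-pair vw w∈)
            a≢b (w≢a ∘ sym) (w≢b ∘ sym)))))

  anyStar : Star
  anyStar = mkStar 0F 0F 0F 1F 1F (λ ()) (λ ())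

  smaller-size : ∀ {W X : Fin n → Bool} → (∀ w → T (W w) → T (X w)) → (∃ λ x → T (X x) × ¬ T (W x)) →
    ∑ (λ w → [ W w ]) < ∑ (λ w → [ X w ])
  smaller-size {W} {X} W⊆X (x , x∈X , x∉W) = ≤-trans (≤-reflexive (sym (trans (∑-distrib-+ (δ x) (λ w → [ W w ]))
    (cong (_+ ∑ (λ w → [ W w ])) (∑-δ1 x))))) (∑-mono pointwise)
    where
    pointwise : ∀ w → δ x w + [ W w ] ≤ [ X w ]
    pointwise w with x ≟ w
    ... | yes refl = ≤-reflexive (trans (cong suc (¬T⇒[]≡0 x∉W)) (sym (T⇒[]≡1 x∈X)))
    ... | no _     = []-mono (W⊆X w)

  colourable-below : ∀ size X → ∑ (λ v → [ X v ]) < size → Colourable X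
  colourable-below (suc size) X (s≤s bound) = by-cases (any? λ v → T? (X v))
    (any? λ v → T? (X v) ×-dec (degreeIn G X v ≤? 1))
    where
    smaller : SmallerColourable X
    smaller W W⊆X missing = colourable-below size W (≤-trans (smaller-size W⊆X missing) bound)
    by-cases : Dec (∃ λ v → T (X v)) → Dec (∃ λ v → T (X v) × degreeIn G X v ≤ 1) → Colourable X
    by-cases (no empty) _ = (λ _ → anyStar) , λ v _ v∈ → ⊥-elim (empty (v , v∈))
    by-cases (yes _) (yes (v , v∈ , small)) = leaf-colourable X v v∈ unique smaller
      where
      unique : ∀ w w′ → T (X w) → Adj G v w → T (X w′) → Adj G v w′ → w ≡ w′
      unique w w′ w∈ vw w′∈ vw′ with w ≟ w′
      ... | yes e = e
      ... | no w≢w′ = ⊥-elim (<⇒≱ (s≤s small)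
              (∑-two (λ w → adj G v w ∧ X w) (T-∧-pair vw w∈) (T-∧-pair vw′ w′∈) w≢w′))
    by-cases (yes nonempty) (no large)
      with Boundary.sparse-cycle planar X subcubic (λ v v∈ → ≰⇒> λ small → large (v , v∈ , small)) nonempty
    ... | m , Z , inX , few = sparse-cycle-colourable G subcubic X (branching G X) (not-branching X) girth Z inX few smaller

  colourable : ∀ X → Colourable X
  colourable X = colourable-below _ X ≤-refl

-- From a labelling to the packing colouring

module Packing {n : ℕ} (G : Graph n) (subcubic : Subcubic G) where

  open Colouring G subcubic

  module _ (σ : Stars) (valid : Valid (λ _ → true) σ) where

    toClass : Colour → Fin 1 ⊎ Fin 4
    toClass zero    = inj₁ zero
    toClass (suc c) = inj₂ c

    toClass-injective : ∀ {c d} → toClass c ≡ toClass d → c ≡ d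
    toClass-injective {zero}  {zero}  _ = refl
    toClass-injective {suc c} {suc d} refl = refl

    dartColour : Fin n → Fin n → Colour
    dartColour u v = colourOf (state σ u v)

    edgeColour : Edge G → Colour
    edgeColour e = dartColour (Edge.lo e) (Edge.hi e)

    Joins : Edge G → Fin n → Fin n → Set
    Joins e u v = (u ≡ Edge.lo e × v ≡ Edge.hi e) ⊎ (u ≡ Edge.hi e × v ≡ Edge.lo e)

    joins-end : ∀ e {u} → u isEndOf e → ∃ (Joins e u)
    joins-end e (inj₁ h) = Edge.hi e , inj₁ (h , refl)
    joins-end e (inj₂ h) = Edge.lo e , inj₂ (h , refl)

    joins-adj : ∀ e {u v} → Joins e u v → Adj G u v
    joins-adj e (inj₁ (refl , refl)) = Edge.adjacent e
    joins-adj e (inj₂ (refl , refl)) = adj-symᵀ G (Edge.adjacent e)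

    joins-colour : ∀ e {u v} → Joins e u v → edgeColour e ≡ dartColour u v
    joins-colour e (inj₁ (refl , refl)) = refl
    joins-colour e (inj₂ (refl , refl)) = fits-colour _ _ (valid _ _ tt tt (Edge.adjacent e))

    edge-≡ : ∀ {e f : Edge G} → Edge.lo e ≡ Edge.lo f → Edge.hi e ≡ Edge.hi f → e ≡ f
    edge-≡ {edge lo hi p a} {edge _ _ q b} refl refl = cong₂ (edge lo hi) (≤-irrelevant p q) (T-irrelevant a b)

    joins-unique : ∀ e f {u v} → Joins e u v → Joins f u v → e ≡ f
    joins-unique e f (inj₁ (refl , refl)) (inj₁ (h , h′)) = edge-≡ h h′
    joins-unique e f (inj₂ (refl , refl)) (inj₂ (h , h′)) = edge-≡ h′ h
    joins-unique e f (inj₁ (refl , refl)) (inj₂ (h , h′)) =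
      ⊥-elim (<-asym (Edge.lo<hi e) (subst₂ _<ᶠ_ (sym h′) (sym h) (Edge.lo<hi f)))
    joins-unique e f (inj₂ (refl , refl)) (inj₁ (h , h′)) =
      ⊥-elim (<-asym (Edge.lo<hi e) (subst₂ _<ᶠ_ (sym h) (sym h′) (Edge.lo<hi f)))

    slot-injective : ∀ {u v w} → Adj G u v → Adj G u w → proj₂ (state σ u v) ≡ proj₂ (state σ u w) → v ≡ w
    slot-injective uv uw h = port-injective uv uw (Star.injective (σ _) h)

    proper : ∀ e f {u} → u isEndOf e → u isEndOf f → edgeColour e ≡ edgeColour f → e ≡ f
    proper e f {u} ue uf eq with joins-end e ue | joins-end f uf
    ... | v , je | w , jf = joins-unique e f je (subst (Joins f u) (sym v≡w) jf)
      where
      v≡w : v ≡ w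
      v≡w = slot-injective (joins-adj e je) (joins-adj f jf)
        (colourOf-injective (Star.label (σ u)) _ _ (trans (sym (joins-colour e je)) (trans eq (joins-colour f jf))))

    joins-ends : ∀ g {u v} → u isEndOf g → v isEndOf g → u ≢ v → Joins g u v
    joins-ends g (inj₁ p) (inj₁ q) u≢v = ⊥-elim (u≢v (trans p (sym q)))
    joins-ends g (inj₁ p) (inj₂ q) u≢v = inj₁ (p , q)
    joins-ends g (inj₂ p) (inj₁ q) u≢v = inj₂ (p , q)
    joins-ends g (inj₂ p) (inj₂ q) u≢v = ⊥-elim (u≢v (trans p (sym q)))

    positive-slot : ∀ P a {c} → colourOf (P , a) ≡ suc c → ∃ λ a′ → a ≡ suc a′
    positive-slot P 0F ()
    positive-slot P (suc a) _ = a , refl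

    -- Unless `u` and `v` coincide, `g` joins them and the colour belongs to both labels. By
    -- `fits-shared`, `g` then uses the slot of `e` at `u`, so `g` would be `e`.
    strong : ∀ e g f {u v c} → e ≢ g → e ≢ f → u isEndOf e → u isEndOf g → v isEndOf g → v isEndOf f →
      edgeColour e ≡ suc c → edgeColour f ≡ suc c → ⊥
    strong e g f {u} {v} e≢g e≢f ue ug vg vf ce cf with u ≟ v
    ... | yes refl = e≢f (proper e f ue vf (trans ce (sym cf)))
    ... | no u≢v with joins-end e ue | joins-end f vf
    ...   | a , je | b , jf with positive-slot _ (proj₂ (state σ u a)) (trans (sym (joins-colour e je)) ce)
                               | positive-slot _ (proj₂ (state σ v b)) (trans (sym (joins-colour f jf)) cf)
    ...     | i , hi | j , hj = e≢g (joins-unique e g je (subst (Joins g u) (sym a≡v) jg))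
      where
      jg : Joins g u v
      jg = joins-ends g ug vg u≢v
      same-colour : colourOf (Star.label (σ u) , suc i) ≡ colourOf (Star.label (σ v) , suc j)
      same-colour = trans (cong (λ s → colourOf (Star.label (σ u) , s)) (sym hi))
        (trans (trans (sym (joins-colour e je)) (trans ce (trans (sym cf) (joins-colour f jf))))
               (cong (λ s → colourOf (Star.label (σ v) , s)) hj))
      a≡v : a ≡ v
      a≡v = slot-injective (joins-adj e je) (joins-adj g jg) (trans hi (sym
        (fits-shared (state σ u v) (state σ v u) (valid u v tt tt (joins-adj g jg)) i j same-colour)))

    toClass-suc : ∀ {c i} → toClass c ≡ inj₂ i → c ≡ suc i
    toClass-suc {suc c} refl = refl

    packing : PackingEdgeColoring 1 4 G
    packing = record
      { colour = toClass ∘ edgeColour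
      ; matching = λ i {e} {f} ce cf → far₂ e f (toClass-injective (trans ce (sym cf)))
      ; induced = λ i {e} {f} ce cf → far₃ e f (toClass-suc ce) (toClass-suc cf) }
      where
      far₂ : ∀ e f → edgeColour e ≡ edgeColour f → e ≢ f → EdgeDistAtLeast G 2 e f
      far₂ e f eq e≢f ε = ⊥-elim (e≢f refl)
      far₂ e f eq e≢f ((_ , w , we , wf) ◅ ε) = ⊥-elim (e≢f (proper e f we wf eq))
      far₂ e f eq e≢f (_ ◅ _ ◅ _) = s≤s (s≤s z≤n)
      far₃ : ∀ e f {c} → edgeColour e ≡ suc c → edgeColour f ≡ suc c → e ≢ f → EdgeDistAtLeast G 3 e f
      far₃ e f ce cf e≢f ε = ⊥-elim (e≢f refl)
      far₃ e f ce cf e≢f ((_ , w , we , wf) ◅ ε) = ⊥-elim (e≢f (proper e f we wf (trans ce (sym cf))))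
      far₃ e f ce cf e≢f (_◅_ {j = g} (e≢g , u , ue , ug) ((_ , v , vg , vf) ◅ ε)) =
        ⊥-elim (strong e g f e≢g e≢f ue ug vg vf ce cf)
      far₃ e f ce cf e≢f (_ ◅ _ ◅ _ ◅ _) = s≤s (s≤s (s≤s z≤n))

theorem1p2 : (n : ℕ) (G : Graph n) → Subcubic G → Planar G →
    GirthAtLeast 16 G → PackingEdgeColoring 1 4 G
theorem1p2 n G subcubic planar girth with colourable G subcubic planar girth (λ _ → true)
... | σ , valid = Packing.packing G subcubic σ valid
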